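{- Given $0<\varepsilon<\frac12$ and $\sigma>0$, there exists a constant $c>0$ such that the following holds. Let $G$ be a tournament on $N$ vertices which is $(\varepsilon,\sigma\log N)$-pseudorandom. Then $G\to(\vec P_n,T)$ for every directed tree $T$ on $m$ vertices, provided $n,m\le N/c$ and $nm\le \frac{N^2}{c^2\log N}$.
   Context: An oriented graph $G$ is $(\varepsilon,k)$-pseudorandom if for all disjoint $A,B\subseteq V(G)$ with $|A|,|B|\ge k$, at least $\varepsilon|A||B|$ edges are directed from $A$ to $B$. A tournament is an orientation of a complete graph. $\vec P_n$ is the directed path on $n$ vertices (all edges oriented in the same direction along the path). An oriented tree is out-directed if there is a vertex (the root) such that all edges are directed away from it, in-directed if all edges are directed towards it; a directed tree is an out-directed or in-directed tree. For oriented graphs $G,H,K$, $G\to(H,K)$ means that in every red/blue colouring of the edges of $G$ there is a blue copy of $H$ or a red copy of $K$ (copies are subgraphs isomorphic as oriented graphs). Logarithms are base $2$. -}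

module Defs where

open import Data.Nat using (ℕ; zero; suc; _+_; _*_; _^_; _≤_; _<_; _≡ᵇ_)
open import Data.Bool using (Bool; true; false; _∧_; _∨_; not; if_then_else_)
open import Data.Fin using (Fin; zero; suc; toℕ; fromℕ; inject₁)
open import Data.Fin.Subset using (Subset; ∣_∣)
open import Data.Vec using (lookup)
open import Data.List using (List; map; allFin)
open import Data.Nat.ListAction using (sum)
open import Data.Product using (Σ; ∃; _×_; _,_)
open import Data.Sum using (_⊎_)
open import Relation.Binary.PropositionalEquality using (_≡_; _≢_)
open import Relation.Nullary using (¬_)
open import Function.Definitions using (Injective)

Digraph : ℕ → Set
Digraph n = Fin n → Fin n → Bool

IsOriented : ∀ {n} → Digraph n → Set
IsOriented {n} E = (∀ u → E u u ≡ false) × (∀ u v → E u v ≡ true → E v u ≡ false)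

IsTournament : ∀ {N} → Digraph N → Set
IsTournament {N} E = (∀ u → E u u ≡ false) × (∀ u v → u ≢ v → E u v ≡ not (E v u))

eCount : ∀ {N} → Digraph N → Subset N → Subset N → ℕ
eCount {N} E A B =
  sum (map (λ u → sum (map (λ v → if lookup A u ∧ lookup B v ∧ E u v then 1 else 0)
                           (allFin N)))
           (allFin N))

Disjoint : ∀ {N} → Subset N → Subset N → Set
Disjoint {N} A B = ∀ u → ¬ (lookup A u ≡ true × lookup B u ≡ true)

-- G is (ε, σ log₂ N)-pseudorandom where ε = εp/εq and σ = σp/σq (N = number of vertices).
-- |A| ≥ (σp/σq)·log₂ N  ⟺  2^(σq·|A|) ≥ N^σp ;  e(A,B) ≥ (εp/εq)|A||B| ⟺ εq·e ≥ εp·|A|·|B|.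
PseudorandomLog : ∀ {N} → Digraph N → (εp εq σp σq : ℕ) → Set
PseudorandomLog {N} E εp εq σp σq =
  ∀ (A B : Subset N) → Disjoint A B →
    N ^ σp ≤ 2 ^ (σq * ∣ A ∣) → N ^ σp ≤ 2 ^ (σq * ∣ B ∣) →
    εp * ∣ A ∣ * ∣ B ∣ ≤ εq * eCount E A B

DirPath : (n : ℕ) → Digraph n
DirPath n i j = suc (toℕ i) ≡ᵇ toℕ j

Adj : ∀ {m} → Digraph m → Fin m → Fin m → Bool
Adj E u v = E u v ∨ E v u

Walk : ∀ {m} → (Fin m → Fin m → Bool) → Fin m → Fin m → Set
Walk {m} R u v = Σ ℕ λ k → Σ (Fin (suc k) → Fin m) λ w →
  (w zero ≡ u) × (w (fromℕ k) ≡ v) × (∀ (i : Fin k) → R (w (inject₁ i)) (w (suc i)) ≡ true)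

HasCycle : ∀ {m} → Digraph m → Set
HasCycle {m} E = Σ ℕ λ k → Σ (Fin (suc (suc (suc k))) → Fin m) λ w →
  Injective _≡_ _≡_ w ×
  (∀ (i : Fin (suc (suc k))) → Adj E (w (inject₁ i)) (w (suc i)) ≡ true) ×
  (Adj E (w (fromℕ (suc (suc k)))) (w zero) ≡ true)

IsOrientedTree : ∀ {m} → Digraph m → Set
IsOrientedTree {m} E = IsOriented E × (∀ u v → Walk (Adj E) u v) × ¬ HasCycle E

-- out-directed: some root r from which every vertex is reached along edges
-- directed away from r (in a tree: all edges point away from r)
IsOutDirected : ∀ {m} → Digraph m → Set
IsOutDirected {m} E = Σ (Fin m) λ r → ∀ v → Walk E r v

IsInDirected : ∀ {m} → Digraph m → Set
IsInDirected {m} E = Σ (Fin m) λ r → ∀ v → Walk E v r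

IsDirectedTree : ∀ {m} → Digraph m → Set
IsDirectedTree E = IsOrientedTree E × (IsOutDirected E ⊎ IsInDirected E)

data Colour : Set where
  red blue : Colour

ColouredCopy : ∀ {N h} → Digraph N → (Fin N → Fin N → Colour) → Colour → Digraph h → Set
ColouredCopy {N} {h} G col κ H = Σ (Fin h → Fin N) λ φ →
  Injective _≡_ _≡_ φ ×
  (∀ u v → H u v ≡ true → (G (φ u) (φ v) ≡ true) × (col (φ u) (φ v) ≡ κ))

Arrows : ∀ {N h k} → Digraph N → Digraph h → Digraph k → Set
Arrows {N} G H K = ∀ (col : Fin N → Fin N → Colour) →
  ColouredCopy G col blue H ⊎ ColouredCopy G col red K

{-# OPTIONS --safe #-}

-- Suppose that there is no blue path on n vertices. Run a depth-first search on the blue graph and let d u be the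
-- length of a longest blue walk from u that always steps to a vertex finished earlier; then d < n. A blue edge u → v
-- either decreases d or leads to an ancestor v of u, and d increases strictly along ancestors. So the levels of d
-- contain no blue edge, and every vertex has at most one blue out-neighbour in each level above its own.
--
-- Cut the levels into cells of size about N / n; from a cell to a block of later cells almost all edges are red.
-- Cut the out-directed tree T into pieces of at most τ ≈ N / n vertices such that at most m / τ cuts lie above each
-- other. The pieces below exactly b cuts are embedded in the b-th of a sequence of blocks of consecutive cells, whose
-- size is proportional to k plus the number of vertices in these pieces, where k ≈ σ log N. By pseudorandomness all
-- but k vertices of a block have many red out-neighbours in the next one; hence the image of the parent of a piece has
-- 2τ unused such out-neighbours in one cell, and a median order of this red tournament contains the piece. In-directed
-- trees are treated by reversing all edges.
module Submission where

open import Defs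
open import Data.Nat
open import Data.Nat.Properties
open import Data.Nat.DivMod using (m≥n⇒m/n>0; m/n*n≤m; m≡m%n+[m/n]*n; m%n<n)
open import Data.Nat.ListAction using (sum)
open import Data.Nat.ListAction.Properties using (sum-++; sum-↭)
open import Data.Nat.Tactic.RingSolver using (solve-∀)
open import Data.Bool using (Bool; true; false; T; if_then_else_; _∧_; _∨_; not)
open import Data.Bool.Properties using (∨-zeroʳ; ∨-comm; T?)
open import Data.Empty using (⊥; ⊥-elim)
open import Data.Unit using (⊤; tt)
open import Data.Product using (Σ; ∃; _×_; _,_; proj₁; proj₂)
open import Data.Sum as Sum using (_⊎_; inj₁; inj₂; [_,_]′)
open import Data.Fin as Fin using (Fin; fromℕ; inject₁; toℕ)
import Data.Fin.Properties as Fin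
open import Data.Fin.Subset using (Subset; ∣_∣)
import Data.Vec as Vec
open import Data.Vec.Properties using (lookup∘tabulate)
open import Data.List using (List; []; _∷_; _++_; _ʳ++_; _∷ʳ_; map; length; concat; filter; take; drop; reverse; lookup; allFin; tabulate)
open import Data.List.Properties
  using (length-++; ++-assoc; ++-identityʳ; ++-ʳ++; length-ʳ++; map-++; length-map; ∷-injectiveˡ; ∷-injectiveʳ; length-drop;
         length-take; take++drop≡id; concat-++; unfold-reverse; length-reverse; length-tabulate; map-cong; map-tabulate)
open import Data.List.Membership.Propositional using (_∈_; _∉_; find)
open import Data.List.Membership.Propositional.Properties
  using (∈-++⁺ˡ; ∈-++⁺ʳ; ∈-++⁻; ∈-∃++; ∈-map⁺; ∈-map⁻; ∈-filter⁻; ∈-concat⁺′; ∈-concat⁻′; ∈-allFin; ∈-lookup)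
open import Data.List.Relation.Unary.Any using (here; there)
open import Data.List.Relation.Unary.All as All using (All; []; _∷_)
import Data.List.Relation.Unary.All.Properties as Allₚ
open import Data.List.Relation.Unary.AllPairs as AllPairs using (AllPairs; []; _∷_)
import Data.List.Relation.Unary.AllPairs.Properties as AllPairsₚ
open import Data.List.Relation.Unary.Unique.Propositional using (Unique)
import Data.List.Relation.Unary.Unique.Propositional.Properties as Uniqueₚ
open import Data.List.Relation.Unary.Linked using (Linked; []; [-]; _∷_)
open import Data.List.Relation.Binary.Permutation.Propositional
  using (_↭_; prep; swap; ↭-refl; ↭-sym; ↭-trans; ↭-reflexive; ↭⇒↭ₛ)
open import Data.List.Relation.Binary.Permutation.Propositional.Properties as ↭
  using (shift; ++⁺; ++⁺ˡ; ++⁺ʳ; ↭-length; ∈-resp-↭)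
import Data.List.Relation.Binary.Permutation.Setoid.Properties as ↭ₛ
open import Function using (_∘_; id)
open import Function.Definitions using (Injective)
open import Relation.Binary using (DecidableEquality)
open import Relation.Binary.PropositionalEquality
open import Relation.Nullary using (¬_; Dec; yes; no; contradiction; does)
open import Relation.Nullary.Decidable using (dec-true; dec-false)
open import Relation.Unary using (Decidable)

-- Blue edges are bounded only upwards in the order of the cells, and absent only inside a cell.
-- Hence a piece of the tree has to lie in a single cell, and every edge between pieces has to climb
-- to a later block; this is why the tree is embedded from its root, with its edges pointing away
-- from it. A new block is expensive: up to `k` of its vertices may be poor, that is, have too few
-- red out-neighbours in the block after it, and these are avoided. With about `m / τ` blocks the
-- loss is of order `k * m / τ`, or `n * m * log N / N`, and the bound on `n * m` keeps it below a
-- small fraction of `N`. The cell size balances two effects: each of the `n` levels wastes less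
-- than one cell, so cells may have order at most `N / n`, while smaller cells mean smaller pieces
-- and more blocks. Towards a block a vertex needs `3 * τ` red out-neighbours per cell on average:
-- one `τ` pays for poor and occupied vertices, two remain for a piece of at most `τ` vertices,
-- because the median order asks for a host of about twice its size.

private variable
  A : Set

true≢false : true ≢ false
true≢false ()

-- Proves a linear inequality x ≤ y: a ≤ b is the sum of the hypotheses and c the slack.
linear : ∀ {a b x y} c → a ≤ b → x + b + c ≡ y + a → x ≤ y
linear {a} {b} {x} {y} c a≤b eq = +-cancelʳ-≤ a x y (begin
  x + a      ≤⟨ +-monoʳ-≤ x a≤b ⟩
  x + b      ≤⟨ m≤m+n (x + b) c ⟩
  x + b + c  ≡⟨ eq ⟩
  y + a      ∎)
  where open ≤-Reasoning

-- Counting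

bit : Bool → ℕ
bit b = if b then 1 else 0

count : (A → Bool) → List A → ℕ
count p xs = sum (map (λ x → bit (p x)) xs)

count-++ : ∀ (p : A → Bool) xs ys → count p (xs ++ ys) ≡ count p xs + count p ys
count-++ p xs ys = trans (cong sum (map-++ _ xs ys)) (sum-++ (map _ xs) (map _ ys))

count-↭ : ∀ (p : A → Bool) {xs ys} → xs ↭ ys → count p xs ≡ count p ys
count-↭ p xs↭ys = sum-↭ (↭.map⁺ _ xs↭ys)

count-ʳ++ : ∀ (p : A → Bool) xs ys → count p (xs ʳ++ ys) ≡ count p xs + count p ys
count-ʳ++ p xs ys = trans (sym (count-↭ p (↭.++↭ʳ++ xs ys))) (count-++ p xs ys)

bit≤1 : ∀ b → bit b ≤ 1
bit≤1 true = s≤s z≤n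
bit≤1 false = z≤n

count≤length : ∀ (p : A → Bool) xs → count p xs ≤ length xs
count≤length p [] = z≤n
count≤length p (x ∷ xs) = +-mono-≤ (bit≤1 (p x)) (count≤length p xs)

sum-map-mono : ∀ (f g : A → ℕ) xs → (∀ {x} → x ∈ xs → f x ≤ g x) → sum (map f xs) ≤ sum (map g xs)
sum-map-mono f g [] h = z≤n
sum-map-mono f g (x ∷ xs) h = +-mono-≤ (h (here refl)) (sum-map-mono f g xs (h ∘ there))

sum-map-+ : ∀ (f g : A → ℕ) xs → sum (map (λ x → f x + g x) xs) ≡ sum (map f xs) + sum (map g xs)
sum-map-+ f g [] = refl
sum-map-+ f g (x ∷ xs) rewrite sum-map-+ f g xs = interchange (f x) (g x) (sum (map f xs)) (sum (map g xs))
  where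
  interchange : ∀ a b c d → a + b + (c + d) ≡ a + c + (b + d)
  interchange = solve-∀

sum-map-* : ∀ c (f : A → ℕ) xs → sum (map (λ x → c * f x) xs) ≡ c * sum (map f xs)
sum-map-* c f [] = sym (*-zeroʳ c)
sum-map-* c f (x ∷ xs) rewrite sum-map-* c f xs = sym (*-distribˡ-+ c (f x) (sum (map f xs)))

sum-map-const : ∀ c (xs : List A) → sum (map (λ _ → c) xs) ≡ c * length xs
sum-map-const c [] = sym (*-zeroʳ c)
sum-map-const c (x ∷ xs) rewrite sum-map-const c xs = sym (*-suc c (length xs))

count-all : ∀ (p : A → Bool) xs → (∀ {x} → x ∈ xs → p x ≡ true) → count p xs ≡ length xs
count-all p [] h = refl
count-all p (x ∷ xs) h rewrite h (here refl) = cong suc (count-all p xs (h ∘ there))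

count-none : ∀ (p : A → Bool) xs → (∀ {x} → x ∈ xs → p x ≡ false) → count p xs ≡ 0
count-none p [] h = refl
count-none p (x ∷ xs) h rewrite h (here refl) = count-none p xs (h ∘ there)

count-witness : ∀ (p q : A → Bool) xs → count p xs < count q xs →
  Σ A λ x → x ∈ xs × q x ≡ true × p x ≡ false
count-witness p q (x ∷ xs) lt with p x in px | q x in qx
... | false | true  = x , here refl , qx , px
... | true  | true  = let y , y∈ , qy , py = count-witness p q xs (s<s⁻¹ lt) in y , there y∈ , qy , py
... | false | false = let y , y∈ , qy , py = count-witness p q xs lt in y , there y∈ , qy , py
... | true  | false = let y , y∈ , qy , py = count-witness p q xs (<-trans (n<1+n _) lt) in y , there y∈ , qy , py

average : ∀ (f : A → ℕ) c xs → c * length xs < sum (map f xs) → Σ A λ x → x ∈ xs × c < f x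
average f c [] lt = contradiction lt (n≮0 ∘ subst (_< 0) (*-zeroʳ c))
average f c (x ∷ xs) lt with c <? f x
... | yes c<fx = x , here refl , c<fx
... | no c≮fx = let y , y∈ , c<fy = average f c xs lt′ in y , there y∈ , c<fy
  where
  lt′ : c * length xs < sum (map f xs)
  lt′ = +-cancelˡ-< c _ _ (<-≤-trans (subst (_< f x + sum (map f xs)) (*-suc c (length xs)) lt)
                                     (+-monoˡ-≤ (sum (map f xs)) (≮⇒≥ c≮fx)))

sum-map-concat : ∀ (f : A → ℕ) xss → sum (map f (concat xss)) ≡ sum (map (λ xs → sum (map f xs)) xss)
sum-map-concat f [] = refl
sum-map-concat f (xs ∷ xss) = trans (cong sum (map-++ f xs (concat xss)))
  (trans (sum-++ (map f xs) _) (cong (sum (map f xs) +_) (sum-map-concat f xss)))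

-- Forests and depth-first search

-- node x fs gs : a tree with root x, whose children form fs, followed by its right siblings gs.
data Forest (A : Set) : Set where
  ∅    : Forest A
  node : A → Forest A → Forest A → Forest A

-- `revPost` is the order of decreasing finishing time: later siblings finish after a whole tree,
-- and a root finishes after its descendants.
roots verts revPost : Forest A → List A
roots ∅ = []
roots (node x fs gs) = x ∷ roots gs
verts ∅ = []
verts (node x fs gs) = x ∷ verts fs ++ verts gs
revPost ∅ = []
revPost (node x fs gs) = revPost gs ++ x ∷ revPost fs

revPost↭verts : (f : Forest A) → revPost f ↭ verts f
revPost↭verts ∅ = ↭-refl
revPost↭verts (node x fs gs) = ↭-trans (shift x (revPost gs) (revPost fs))
  (prep x (↭-trans (↭.++-comm (revPost gs) (revPost fs)) (++⁺ (revPost↭verts fs) (revPost↭verts gs))))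

roots⊆verts : (f : Forest A) → ∀ {x} → x ∈ roots f → x ∈ verts f
roots⊆verts (node x fs gs) (here refl) = here refl
roots⊆verts (node x fs gs) (there x∈) = there (∈-++⁺ʳ (verts fs) (roots⊆verts gs x∈))

data Edge {A : Set} : Forest A → A → A → Set where
  root   : ∀ {x fs gs y} → y ∈ roots fs → Edge (node x fs gs) x y
  child  : ∀ {x fs gs a b} → Edge fs a b → Edge (node x fs gs) a b
  sibling : ∀ {x fs gs a b} → Edge gs a b → Edge (node x fs gs) a b

Unique-++ˡ : ∀ (xs : List A) {ys} → Unique (xs ++ ys) → Unique xs
Unique-++ˡ [] u = []
Unique-++ˡ (x ∷ xs) (x∉ ∷ u) = Allₚ.++⁻ˡ xs x∉ ∷ Unique-++ˡ xs u

Unique-++ʳ : ∀ (xs : List A) {ys} → Unique (xs ++ ys) → Unique ys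
Unique-++ʳ [] u = u
Unique-++ʳ (x ∷ xs) (x∉ ∷ u) = Unique-++ʳ xs u

Unique-++-disjoint : ∀ (xs : List A) {ys v} → Unique (xs ++ ys) → v ∈ xs → v ∈ ys → ⊥
Unique-++-disjoint (x ∷ xs) (x∉ ∷ u) (here refl) v∈ys = All.lookup (Allₚ.++⁻ʳ xs x∉) v∈ys refl
Unique-++-disjoint (x ∷ xs) (x∉ ∷ u) (there v∈xs) v∈ys = Unique-++-disjoint xs u v∈xs v∈ys

Unique-↭ : ∀ {xs ys : List A} → xs ↭ ys → Unique xs → Unique ys
Unique-↭ p = ↭ₛ.Unique-resp-↭ (setoid _) (↭⇒↭ₛ p)

module _ {A : Set} (E : A → A → Bool) where

  NoEdges : List A → List A → Set
  NoEdges xs ys = ∀ {x y} → x ∈ xs → y ∈ ys → E x y ≡ false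

  -- Forests that arise from a depth-first search, which leaves a vertex only when it has no unexplored out-neighbour.
  data DFS : Forest A → Set where
    ∅    : DFS ∅
    node : ∀ {x fs gs} → (∀ {y} → y ∈ roots fs → E x y ≡ true) → NoEdges (x ∷ verts fs) (verts gs) →
           DFS fs → DFS gs → DFS (node x fs gs)

  search : ∀ (P : A → Bool) U → (∀ {y} → y ∈ U → P y ≡ false) ⊎ Σ A λ x → Σ (List A) λ U′ → P x ≡ true × x ∷ U′ ↭ U
  search P [] = inj₁ λ ()
  search P (x ∷ U) with P x in px
  ... | true = inj₂ (x , U , px , ↭-refl)
  ... | false with search P U
  ... | inj₁ none = inj₁ λ { (here refl) → px ; (there y∈) → none y∈ }
  ... | inj₂ (y , U′ , py , p) = inj₂ (y , x ∷ U′ , py , ↭-trans (swap y x ↭-refl) (prep x p))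

  -- `P` marks the admissible roots; below a vertex `x` it is `E x`. When the call for the children
  -- returns, no unvisited vertex is an out-neighbour of `x` or of a descendant, and this yields the
  -- absence of edges to later trees and to the remainder.
  dfs : ∀ fuel (P : A → Bool) U → length U ≤ fuel → Σ (Forest A) λ f → Σ (List A) λ U′ →
    verts f ++ U′ ↭ U × DFS f × (∀ {y} → y ∈ roots f → P y ≡ true) ×
    (∀ {y} → y ∈ U′ → P y ≡ false) × NoEdges (verts f) U′
  dfs fuel P U len with search P U
  ... | inj₁ none = ∅ , U , ↭-refl , ∅ , (λ ()) , none , λ ()
  dfs zero P [] len | inj₂ (x , U₁ , px , p) = contradiction (↭.↭-empty-inv p) λ ()
  dfs (suc fuel) P U len | inj₂ (x , U₁ , px , p)
    with len₁ ← s≤s⁻¹ (subst (_≤ suc fuel) (sym (↭-length p)) len)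
    with dfs fuel (E x) U₁ len₁
  ... | fs , U₂ , p₁ , ok₁ , r₁ , n₁ , e₁
    with dfs fuel P U₂ (≤-trans (≤-trans (m≤n+m (length U₂) (length (verts fs)))
                         (≤-reflexive (trans (sym (length-++ (verts fs))) (↭-length p₁)))) len₁)
  ... | gs , U₃ , p₂ , ok₂ , r₂ , n₂ , e₂ =
    node x fs gs , U₃
    , ↭-trans (prep x (↭-trans (↭-reflexive (++-assoc (verts fs) (verts gs) U₃))
                               (↭-trans (++⁺ˡ (verts fs) p₂) p₁))) p
    , node r₁ (λ x∈ y∈ → out x∈ (∈-++⁺ˡ y∈)) ok₁ ok₂
    , (λ { (here refl) → px ; (there y∈) → r₂ y∈ })
    , n₂
    , λ { (here refl) y∈ → out (here refl) (∈-++⁺ʳ (verts gs) y∈)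
        ; (there x∈) y∈ → rest (∈-++⁻ (verts fs) x∈) y∈ }
    where
    out : ∀ {u v} → u ∈ x ∷ verts fs → v ∈ verts gs ++ U₃ → E u v ≡ false
    out (here refl) v∈ = n₁ (∈-resp-↭ p₂ v∈)
    out (there u∈) v∈ = e₁ u∈ (∈-resp-↭ p₂ v∈)
    rest : ∀ {u v} → u ∈ verts fs ⊎ u ∈ verts gs → v ∈ U₃ → E u v ≡ false
    rest (inj₁ u∈) v∈ = out (there u∈) (∈-++⁺ʳ (verts gs) v∈)
    rest (inj₂ u∈) v∈ = e₂ u∈ v∈

-- Levels of a digraph without long paths

IsPath : (A → A → Bool) → List A → Set
IsPath E p = Unique p × Linked (λ x y → E x y ≡ true) p

Levelling : (A → A → Bool) → ℕ → List A → Set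
Levelling {A} E n U = Σ (A → ℕ) λ d → (∀ {v} → v ∈ U → d v < n) ×
  (∀ {u v} → u ∈ U → v ∈ U → E u v ≡ true → d u ≢ d v) ×
  (∀ {u v w} → u ∈ U → v ∈ U → w ∈ U → E u v ≡ true → E u w ≡ true → d u ≤ d v → d v ≡ d w → v ≡ w)

module _ {A : Set} (_≟_ : DecidableEquality A) (E : A → A → Bool) where

  -- For a list in decreasing order of finishing time, height l v is the length of a longest walk that starts
  -- at v and always steps to a vertex finished earlier.
  height : List A → A → ℕ
  steps : List A → A → List A → ℕ
  height [] v = 0
  height (u ∷ l) v = if does (v ≟ u) then steps l u l else height l v
  steps l u [] = 0
  steps l u (x ∷ xs) = (if E u x then suc (height l x) else 0) ⊔ steps l u xs

  steps-≥ : ∀ l u {x} xs → x ∈ xs → E u x ≡ true → height l x < steps l u xs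
  steps-≥ l u (x ∷ xs) (here refl) eux rewrite eux = m≤m⊔n _ (steps l u xs)
  steps-≥ l u (x ∷ xs) (there x∈) eux = ≤-trans (steps-≥ l u xs x∈ eux) (m≤n⊔m _ (steps l u xs))

  steps-attained : ∀ l u xs {h} → steps l u xs ≡ suc h → Σ A λ x → x ∈ xs × E u x ≡ true × height l x ≡ h
  steps-attained l u (x ∷ xs) eq with E u x in eux
  ... | false = let y , y∈ , r = steps-attained l u xs eq in y , there y∈ , r
  ... | true with ⊔-sel (suc (height l x)) (steps l u xs)
  ... | inj₁ s = x , here refl , eux , suc-injective (trans (sym s) eq)
  ... | inj₂ s = let y , y∈ , r = steps-attained l u xs (trans (sym s) eq) in y , there y∈ , r

  height-head : ∀ u l → height (u ∷ l) u ≡ steps l u l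
  height-head u l with u ≟ u
  ... | yes _ = refl
  ... | no u≢u = contradiction refl u≢u

  height-tail : ∀ {u} l {v} → v ≢ u → height (u ∷ l) v ≡ height l v
  height-tail {u} l {v} v≢u with v ≟ u
  ... | yes v≡u = contradiction v≡u v≢u
  ... | no _ = refl

  -- By uniqueness, prepending vertices to the list does not change the height of those already in
  -- it. So one may assume that `y` is the head, where its height is a maximum over the tail `b`.
  height-decreases : ∀ l → Unique l → ∀ a {y b x} → l ≡ a ++ y ∷ b → x ∈ b → E y x ≡ true → height l x < height l y
  height-decreases (y ∷ b) (y∉b ∷ u) [] refl x∈b eyx
    rewrite height-head y b | height-tail {y} b (All.lookup y∉b x∈b ∘ sym) = steps-≥ b y b x∈b eyx
  height-decreases (z ∷ l) (z∉l ∷ u) (z ∷ a) {y} {b} refl x∈b eyx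
    rewrite height-tail {z} (a ++ y ∷ b) (All.lookup z∉l (∈-++⁺ʳ a (there x∈b)) ∘ sym)
          | height-tail {z} (a ++ y ∷ b) (All.lookup z∉l (∈-++⁺ʳ a (here refl)) ∘ sym)
    = height-decreases l u a refl x∈b eyx

  height-step : ∀ l → Unique l → ∀ {v h} → v ∈ l → height l v ≡ suc h →
                Σ A λ x → x ∈ l × E v x ≡ true × height l x ≡ h
  height-step (u ∷ l) (u∉l ∷ un) (here refl) eq =
    let x , x∈ , e , hx = steps-attained l u l (trans (sym (height-head u l)) eq)
    in x , there x∈ , e , trans (height-tail l (All.lookup u∉l x∈ ∘ sym)) hx
  height-step (u ∷ l) (u∉l ∷ un) {v} (there v∈) eq =
    let x , x∈ , e , hx = height-step l un v∈ (trans (sym (height-tail l (All.lookup u∉l v∈ ∘ sym))) eq)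
    in x , there x∈ , e , trans (height-tail l (All.lookup u∉l x∈ ∘ sym)) hx

  -- Each step lowers the height by exactly one. The bound on the heights in `p` is carried along
  -- because it shows that the walk never returns to a vertex.
  descending-path : ∀ l → Unique l → ∀ n {v h} → v ∈ l → height l v ≡ h → n ≤ h →
    Σ (List A) λ p → length p ≡ n × IsPath E (v ∷ p) × All (λ x → height l x < h) p
  descending-path l u zero v∈ eq n≤h = [] , refl , ([] ∷ [] , [-]) , []
  descending-path l u (suc n) {v} {suc h} v∈ eq (s≤s n≤h) =
    let x , x∈ , e , hx = height-step l u v∈ eq
        p , len , (un , lk) , lt = descending-path l u n x∈ hx n≤h
        lt′ = ≤-reflexive (cong suc hx) ∷ All.map m<n⇒m<1+n lt
    in x ∷ p , cong suc len
       , (All.map (λ y<h v≡y → <-irrefl (trans (cong (height l) (sym v≡y)) eq) y<h) lt′ ∷ un , e ∷ lk) , lt′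

  module _ (d : A → ℕ) where

    -- The property of `height l` that the forest induction needs; unlike the heights themselves it
    -- passes to segments of the list with the same `d`.
    Decreasing : List A → Set
    Decreasing l = ∀ a {y b x} → l ≡ a ++ y ∷ b → x ∈ b → E y x ≡ true → d x < d y

    decreasing-++ʳ : ∀ xs {ys} → Decreasing (xs ++ ys) → Decreasing ys
    decreasing-++ʳ xs dec a refl = dec (xs ++ a) (sym (++-assoc xs a _))

    decreasing-++ˡ : ∀ xs {ys} → Decreasing (xs ++ ys) → Decreasing xs
    decreasing-++ˡ xs {ys} dec a {y} {b} refl x∈ = dec a (++-assoc a (y ∷ b) ys) (∈-++⁺ˡ x∈)

    -- `as` lists the proper ancestors of `u`, starting from its parent. The root `r` with the
    -- largest `d` serves the induction: a new root `w` above the forest has an edge to `r`, whence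
    -- `d r < d w`, and `w` can be appended to `as`.
    Ancestors : Forest A → A → Set
    Ancestors f u = Σ (List A) λ as → AllPairs (λ x y → d x < d y) (u ∷ as) ×
      (∃ λ r → r ∈ roots f × All (λ x → d x ≤ d r) (u ∷ as)) ×
      (∀ {v} → v ∈ verts f → E u v ≡ true → d v < d u ⊎ v ∈ as)

    ancestors : (∀ v → E v v ≡ false) → ∀ f → DFS E f → Decreasing (revPost f) → ∀ {u} → u ∈ verts f → Ancestors f u
    ancestors irr (node w fs gs) (node toRoots noCross ok₁ ok₂) dec = go
      where
      ∈revPost : ∀ f {v} → v ∈ verts f → v ∈ revPost f
      ∈revPost f = ∈-resp-↭ (↭-sym (revPost↭verts f))
      -- An edge from a later tree into an earlier one follows the order of `revPost`.
      before : ∀ {u v} → u ∈ verts gs → v ∈ w ∷ revPost fs → E u v ≡ true → d v < d u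
      before {u} u∈ v∈ e with ∈-∃++ (∈revPost gs u∈)
      ... | a , b , eq = dec a (trans (cong (_++ w ∷ revPost fs) eq) (++-assoc a (u ∷ b) _)) (∈-++⁺ʳ b v∈) e
      below : ∀ {v} → v ∈ verts fs → E w v ≡ true → d v < d w
      below v∈ = dec (revPost gs) refl (∈revPost fs v∈)
      go : ∀ {u} → u ∈ w ∷ verts fs ++ verts gs → Ancestors (node w fs gs) u
      go (here refl) = [] , [] ∷ [] , (w , here refl , ≤-refl ∷ []) , cases
        where
        cases : ∀ {v} → v ∈ w ∷ verts fs ++ verts gs → E w v ≡ true → d v < d w ⊎ v ∈ []
        cases (here refl) e = contradiction (trans (sym e) (irr w)) true≢false
        cases (there v∈) e with ∈-++⁻ (verts fs) v∈
        ... | inj₁ v∈fs = inj₁ (below v∈fs e)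
        ... | inj₂ v∈gs = contradiction (trans (sym e) (noCross (here refl) v∈gs)) true≢false
      go {u} (there u∈) with ∈-++⁻ (verts fs) u∈
      ... | inj₂ u∈gs with ancestors irr gs ok₂ (decreasing-++ˡ (revPost gs) dec) u∈gs
      ...   | as , inc , (r , r∈ , ≤r) , cov = as , inc , (r , there r∈ , ≤r) , cases
        where
        cases : ∀ {v} → v ∈ w ∷ verts fs ++ verts gs → E u v ≡ true → d v < d u ⊎ v ∈ as
        cases (here refl) e = inj₁ (before u∈gs (here refl) e)
        cases (there v∈) e with ∈-++⁻ (verts fs) v∈
        ... | inj₁ v∈fs = inj₁ (before u∈gs (there (∈revPost fs v∈fs)) e)
        ... | inj₂ v∈gs = cov v∈gs e
      go {u} (there u∈) | inj₁ u∈fs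
        with ancestors irr fs ok₁ (decreasing-++ʳ (w ∷ []) (decreasing-++ʳ (revPost gs) dec)) u∈fs
      ... | as , inc , (r , r∈ , ≤r) , cov =
        as ++ w ∷ [] , AllPairsₚ.++⁺ inc ([] ∷ []) (All.map (λ x≤r → ≤-<-trans x≤r r<w ∷ []) ≤r)
        , (w , here refl , Allₚ.++⁺ (All.map (λ x≤r → ≤-trans x≤r (<⇒≤ r<w)) ≤r) (≤-refl ∷ [])) , cases
        where
        r<w : d r < d w
        r<w = below (roots⊆verts fs r∈) (toRoots r∈)
        cases : ∀ {v} → v ∈ w ∷ verts fs ++ verts gs → E u v ≡ true → d v < d u ⊎ v ∈ as ++ w ∷ []
        cases (here refl) e = inj₂ (∈-++⁺ʳ as (here refl))
        cases (there v∈) e with ∈-++⁻ (verts fs) v∈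
        ... | inj₂ v∈gs = contradiction (trans (sym e) (noCross (there u∈fs) v∈gs)) true≢false
        ... | inj₁ v∈fs with cov v∈fs e
        ...   | inj₁ lt = inj₁ lt
        ...   | inj₂ v∈as = inj₂ (∈-++⁺ˡ v∈as)

  increasing-injective : ∀ (d : A → ℕ) {l} → AllPairs (λ x y → d x < d y) l → ∀ {x y} → x ∈ l → y ∈ l → d x ≡ d y → x ≡ y
  increasing-injective d (_ ∷ inc) (here refl) (here refl) eq = refl
  increasing-injective d (lt ∷ inc) (here refl) (there y∈) eq = contradiction (All.lookup lt y∈) (<-irrefl eq)
  increasing-injective d (lt ∷ inc) (there x∈) (here refl) eq = contradiction (All.lookup lt x∈) (<-irrefl (sym eq))
  increasing-injective d (_ ∷ inc) (there x∈) (there y∈) eq = increasing-injective d inc x∈ y∈ eq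

  levelling : (∀ v → E v v ≡ false) → ∀ n U → Unique U →
    (Σ (List A) λ p → length p ≡ suc n × IsPath E p) ⊎ Levelling E (suc n) U
  -- Every vertex is admissible as a root, so the search leaves nothing over; the last clause
  -- refutes a nonempty remainder.
  levelling irr n U uU with dfs E (length U) (λ _ → true) U ≤-refl
  ... | f , [] , p , ok , _ , _ , _ with All.all? (λ v → height (revPost f) v ≤? n) U
  ...   | no ¬small =
          let v , v∈ , big = find (Allₚ.¬All⇒Any¬ (λ v → height (revPost f) v ≤? n) U ¬small)
              p , len , path , _ = descending-path (revPost f) uR n (∈R v∈) refl (<⇒≤ (≰⇒> big))
          in inj₁ (v ∷ p , cong suc len , path)
    where
    f↭U = subst (_↭ U) (++-identityʳ (verts f)) p
    uR = Unique-↭ (↭-trans (↭-sym f↭U) (↭-sym (revPost↭verts f))) uU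
    ∈R : ∀ {v} → v ∈ U → v ∈ revPost f
    ∈R = ∈-resp-↭ (↭-trans (↭-sym f↭U) (↭-sym (revPost↭verts f)))
  ...   | yes small = inj₂ (d , (λ v∈ → s≤s (All.lookup small v∈)) , apart , single)
    where
    d = height (revPost f)
    f↭U = subst (_↭ U) (++-identityʳ (verts f)) p
    uR = Unique-↭ (↭-trans (↭-sym f↭U) (↭-sym (revPost↭verts f))) uU
    ∈f : ∀ {v} → v ∈ U → v ∈ verts f
    ∈f = ∈-resp-↭ (↭-sym f↭U)
    anc : ∀ {u} → u ∈ U → Ancestors d f u
    anc u∈ = ancestors d irr f ok (height-decreases (revPost f) uR) (∈f u∈)
    apart : ∀ {u v} → u ∈ U → v ∈ U → E u v ≡ true → d u ≢ d v
    apart u∈ v∈ e eq with anc u∈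
    ... | as , inc , _ , cov with cov (∈f v∈) e
    ... | inj₁ lt = <-irrefl (sym eq) lt
    ... | inj₂ v∈as = <-irrefl eq (All.lookup (AllPairs.head inc) v∈as)
    single : ∀ {u v w} → u ∈ U → v ∈ U → w ∈ U → E u v ≡ true → E u w ≡ true → d u ≤ d v → d v ≡ d w → v ≡ w
    single u∈ v∈ w∈ ev ew le eq with anc u∈
    ... | as , inc , _ , cov with cov (∈f v∈) ev | cov (∈f w∈) ew
    ... | inj₁ lt | _ = contradiction lt (≤⇒≯ le)
    ... | inj₂ _ | inj₁ lt = contradiction lt (≤⇒≯ (≤-trans le (≤-reflexive eq)))
    ... | inj₂ v∈as | inj₂ w∈as = increasing-injective d (AllPairs.tail inc) v∈as w∈as eq
  levelling irr n U uU | f , x ∷ U′ , p , ok , _ , none , _ with () ← none (here refl)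

-- Median orders and trees in tournaments

-- Preorder: every parent has appeared before its children, so the tree can be grown by one leaf at
-- a time. `p` acts as the parent of the roots.
pairs : A → Forest A → List (A × A)
pairs p ∅ = []
pairs p (node x fs gs) = (p , x) ∷ pairs x fs ++ pairs p gs

map-pairs : ∀ (p : A) f → map proj₂ (pairs p f) ≡ verts f
map-pairs p ∅ = refl
map-pairs p (node x fs gs) = cong (x ∷_) (trans (map-++ proj₂ (pairs x fs) (pairs p gs))
                                                (cong₂ _++_ (map-pairs x fs) (map-pairs p gs)))

root⇒pair : ∀ (p : A) f {x} → x ∈ roots f → (p , x) ∈ pairs p f
root⇒pair p (node x fs gs) (here refl) = here refl
root⇒pair p (node x fs gs) (there x∈) = there (∈-++⁺ʳ (pairs x fs) (root⇒pair p gs x∈))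

edge⇒pair : ∀ (p : A) f {x y} → Edge f x y → (x , y) ∈ pairs p f
edge⇒pair p (node x fs gs) (root y∈) = there (∈-++⁺ˡ (root⇒pair x fs y∈))
edge⇒pair p (node x fs gs) (child e) = there (∈-++⁺ˡ (edge⇒pair x fs e))
edge⇒pair p (node x fs gs) (sibling e) = there (∈-++⁺ʳ (pairs x fs) (edge⇒pair p gs e))

Grown : List A → List (A × A) → Set
Grown known [] = ⊤
Grown known ((p , c) ∷ es) = p ∈ known × Grown (c ∷ known) es

-- The edges `es` come after all of `f`, when more vertices are known; the hypothesis on them
-- therefore quantifies over every larger list.
grown-pairs : ∀ {p : A} f {known es} → p ∈ known → (∀ {known′} → (∀ {x} → x ∈ known → x ∈ known′) → Grown known′ es) →
              Grown known (pairs p f ++ es)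
grown-pairs ∅ p∈ k = k id
grown-pairs {p = p} (node x fs gs) {es = es} p∈ k
  rewrite ++-assoc (pairs x fs) (pairs p gs) es =
  p∈ , grown-pairs fs (here refl) λ ⊆ → grown-pairs gs (⊆ (there p∈)) λ ⊆′ → k (⊆′ ∘ ⊆ ∘ there)

ʳ++-++ : ∀ (xs : List A) {ys zs} → xs ʳ++ ys ++ zs ≡ (xs ʳ++ ys) ++ zs
ʳ++-++ [] = refl
ʳ++-++ (x ∷ xs) = ʳ++-++ xs

module _ {V : Set} (R : V → V → Bool) where

  -- The feedback property of median orders, for intervals that begin at `x`: in a tournament, `x`
  -- beats at least half of each interval directly after it.
  Dominates : V → List V → Set
  Dominates x l = ∀ q r → l ≡ q ++ r → count (λ y → R y x) q ≤ count (R x) q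

  data Median : List V → Set where
    []  : Median []
    _∷_ : ∀ {x l} → Dominates x l → Median l → Median (x ∷ l)

  median-ʳ++⁻ : ∀ c {l} → Median (c ʳ++ l) → Median l
  median-ʳ++⁻ [] m = m
  median-ʳ++⁻ (x ∷ c) m with _ ∷ m′ ← median-ʳ++⁻ c m = m′

  -- `i` and `o` accumulate the in- and out-edges between `x` and the part of the list already
  -- scanned.
  dominates? : ∀ x i o l → (∀ q r → l ≡ q ++ r → i + count (λ y → R y x) q ≤ o + count (R x) q) ⊎
    (Σ (List V) λ q → Σ (List V) λ r → l ≡ q ++ r × o + count (R x) q < i + count (λ y → R y x) q)
  dominates? x i o l with i ≤? o
  ... | no i≰o = inj₂ ([] , l , refl , +-monoˡ-< 0 (≰⇒> i≰o))
  dominates? x i o [] | yes i≤o = inj₁ λ { [] r eq → +-monoˡ-≤ 0 i≤o }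
  dominates? x i o (y ∷ l) | yes i≤o with dominates? x (i + bit (R y x)) (o + bit (R x y)) l
  ... | inj₁ dom = inj₁ λ { [] r eq → +-monoˡ-≤ 0 i≤o
                          ; (y ∷ q) r refl → subst₂ _≤_ (+-assoc i _ _) (+-assoc o _ _) (dom q r refl) }
  ... | inj₂ (q , r , refl , lt) = inj₂ (y ∷ q , r , refl , subst₂ _<_ (+-assoc o _ _) (+-assoc i _ _) lt)

  forward : List V → ℕ
  forward [] = 0
  forward (x ∷ l) = count (R x) l + forward l

  -- Moving `x` behind `q` trades the edges from `x` to `q` for those from `q` to `x`; all other
  -- pairs keep their order. So a violation of `Dominates` lets the number of forward edges grow.
  forward-move : ∀ x q r → forward (q ++ x ∷ r) + count (R x) q ≡ forward (x ∷ q ++ r) + count (λ y → R y x) q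
  forward-move x [] r = refl
  forward-move x (y ∷ q) r
    rewrite count-++ (R y) q (x ∷ r) | count-++ (R y) q r = begin
      (cyq + (byx + cyr) + fqxr) + (bxy + cxq)  ≡⟨ r₁ cyq byx cyr fqxr bxy cxq ⟩
      cyq + (byx + cyr) + bxy + (fqxr + cxq)    ≡⟨ cong (cyq + (byx + cyr) + bxy +_) (forward-move x q r) ⟩
      cyq + (byx + cyr) + bxy + (cxqr + fqr + iq) ≡⟨ r₂ cyq byx cyr bxy cxqr fqr iq ⟩
      (bxy + cxqr + (cyq + cyr + fqr)) + (byx + iq) ∎
    where
    open ≡-Reasoning
    cyq = count (R y) q
    byx = bit (R y x)
    bxy = bit (R x y)
    cyr = count (R y) r
    cxq = count (R x) q
    cxqr = count (R x) (q ++ r)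
    iq = count (λ y → R y x) q
    fqxr = forward (q ++ x ∷ r)
    fqr = forward (q ++ r)
    r₁ : ∀ a b c d e f → a + (b + c) + d + (e + f) ≡ a + (b + c) + e + (d + f)
    r₁ = solve-∀
    r₂ : ∀ a b c d e f g → a + (b + c) + d + (e + f + g) ≡ d + e + (a + c + f) + (b + g)
    r₂ = solve-∀

  improve : ∀ l → Median l ⊎ (Σ (List V) λ l′ → l′ ↭ l × forward l < forward l′)
  improve [] = inj₁ []
  improve (x ∷ l) with improve l
  ... | inj₂ (l′ , p , lt) = inj₂ (x ∷ l′ , prep x p , +-mono-≤-< (≤-reflexive (sym (count-↭ (R x) p))) lt)
  ... | inj₁ med with dominates? x 0 0 l
  ...   | inj₁ dom = inj₁ (dom ∷ med)
  ...   | inj₂ (q , r , refl , lt) = inj₂ (q ++ x ∷ r , shift x q r ,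
            +-cancelʳ-< (count (R x) q) (forward (x ∷ q ++ r)) (forward (q ++ x ∷ r))
              (≤-trans (+-monoʳ-< (forward (x ∷ q ++ r)) lt) (≤-reflexive (sym (forward-move x q r)))))

  forward-bound : ∀ l → forward l ≤ length l * length l
  forward-bound [] = z≤n
  forward-bound (x ∷ l) = +-mono-≤ (≤-trans (count≤length (R x) l) (n≤1+n _))
    (≤-trans (forward-bound l) (*-monoʳ-≤ (length l) (n≤1+n (length l))))

  -- Every improvement adds a forward edge, and there are at most `length l * length l` of them, so
  -- the fuel bounds the improvements still possible.
  median : ∀ fuel l → length l * length l ≤ fuel + forward l → Σ (List V) λ l′ → l′ ↭ l × Median l′
  median fuel l bound with improve l
  ... | inj₁ med = l , ↭-refl , med
  median zero l bound | inj₂ (l′ , p , lt) =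
    contradiction (<-≤-trans lt (≤-trans (forward-bound l′) (≤-trans (≤-reflexive (cong (λ k → k * k) (↭-length p))) bound)))
                  (<-irrefl refl)
  median (suc fuel) l bound | inj₂ (l′ , p , lt)
    with l″ , p′ , med ← median fuel l′ (≤-trans (≤-reflexive (cong (λ k → k * k) (↭-length p)))
           (≤-trans bound (≤-trans (≤-reflexive (sym (+-suc fuel (forward l)))) (+-monoʳ-≤ fuel lt))))
    = l″ , ↭-trans p′ p , med

does-true : ∀ {P : Set} (P? : Dec P) → does P? ≡ true → P
does-true (yes p) _ = p

count-≟≤1 : ∀ {V : Set} (_≟_ : DecidableEquality V) v l → Unique l → count (λ w → does (w ≟ v)) l ≤ 1
count-≟≤1 _≟_ v [] _ = z≤n
count-≟≤1 _≟_ v (x ∷ l) (x∉ ∷ u) with x ≟ v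
... | no _ = count-≟≤1 _≟_ v l u
... | yes refl = s≤s (≤-reflexive (count-none _ l λ {y} y∈ → dec-false (y ≟ x) (All.lookup x∉ y∈ ∘ sym)))

bit-∨ : ∀ a b → bit (a ∨ b) ≤ bit a + bit b
bit-∨ true b = s≤s z≤n
bit-∨ false b = ≤-refl

count-∨ : ∀ {V : Set} (p q : V → Bool) xs → count (λ x → p x ∨ q x) xs ≤ count p xs + count q xs
count-∨ p q xs = ≤-trans (sum-map-mono _ _ xs (λ {x} _ → bit-∨ (p x) (q x))) (≤-reflexive (sum-map-+ _ _ xs))

Tournament : ∀ {V : Set} → (V → V → Bool) → List V → Set
Tournament R l = ∀ {x y} → x ∈ l → y ∈ l → x ≢ y → R x y ≡ true ⊎ R y x ≡ true

Joined : ∀ {V L : Set} → (V → V → Bool) → List (L × V) → L × L → Set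
Joined R asg (x , y) = ∃ λ u → ∃ λ v → (x , u) ∈ asg × (y , v) ∈ asg × R u v ≡ true

module _ {V L : Set} (_≟_ : DecidableEquality V) (R : V → V → Bool) where

  -- ra is the reversed active prefix of a median order; it grows by two vertices whenever a leaf is added, so
  -- that every final segment b of it contains at most (|b| + 1) / 2 used vertices.
  grow : ∀ es (asg : List (L × V)) (used : V → Bool) ra rest →
    Median R (ra ʳ++ rest) → Unique (ra ʳ++ rest) → Tournament R (ra ʳ++ rest) → 2 * length es ≤ length rest →
    (∀ {x} → x ∈ map proj₂ asg → used x ≡ true) → (∀ {x} → used x ≡ true → x ∈ ra) → Unique (map proj₂ asg) →
    (∀ b c → ra ≡ b ++ c → 2 * count used b ≤ suc (length b)) → Grown (map proj₁ asg) es →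
    Σ (List (L × V)) λ asg′ → map proj₁ asg′ ↭ map proj₂ es ++ map proj₁ asg × Unique (map proj₂ asg′) ×
      (∀ {x} → x ∈ map proj₂ asg′ → x ∈ ra ʳ++ rest) × (∀ {z} → z ∈ asg → z ∈ asg′) × (∀ {e} → e ∈ es → Joined R asg′ e)
  grow [] asg used ra rest med un tour len asg⊆used used⊆ra unA bal gr =
    asg , ↭-refl , unA , (λ x∈ → ∈-resp-↭ (↭.++↭ʳ++ ra rest) (∈-++⁺ˡ (used⊆ra (asg⊆used x∈)))) , id , λ ()
  grow ((p , c) ∷ es) asg used ra (y ∷ z ∷ rest) med un tour len asg⊆used used⊆ra unA bal (p∈ , gr)
    with (_ , u) , u∈asg , refl ← ∈-map⁻ proj₁ p∈
    with b , a , refl ← ∈-∃++ (used⊆ra (asg⊆used (∈-map⁺ proj₂ u∈asg))) = result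
    where
    l = ra ʳ++ (y ∷ z ∷ rest)
    -- The interval of the median order right after `u`, up to and including the two vertices that
    -- become active now.
    q = b ʳ++ (y ∷ z ∷ [])
    l≡ : l ≡ a ʳ++ (u ∷ q ++ rest)
    l≡ = trans (++-ʳ++ b) (cong (λ t → a ʳ++ (u ∷ t)) (ʳ++-++ b))
    l↭ : ra ++ y ∷ z ∷ rest ↭ l
    l↭ = ↭.++↭ʳ++ ra (y ∷ z ∷ rest)
    un′ : Unique (ra ++ y ∷ z ∷ rest)
    un′ = Unique-↭ (↭-sym l↭) un
    q↭ : b ++ y ∷ z ∷ [] ↭ q
    q↭ = ↭.++↭ʳ++ b (y ∷ z ∷ [])
    unTail : Unique (u ∷ q ++ rest)
    unTail = Unique-++ʳ a (Unique-↭ (↭-trans (↭-reflexive l≡) (↭-sym (↭.++↭ʳ++ a (u ∷ q ++ rest)))) un)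
    q⊆l : ∀ {w} → w ∈ u ∷ q → w ∈ l
    q⊆l w∈ = subst (_ ∈_) (sym l≡) (∈-resp-↭ (↭.++↭ʳ++ a (u ∷ q ++ rest)) (∈-++⁺ʳ a (∈-++⁺ˡ w∈)))
    used-yz : ∀ {w} → w ∈ y ∷ z ∷ rest → used w ≡ false
    used-yz {w} w∈ with used w in eq
    ... | false = refl
    ... | true = contradiction w∈ (Unique-++-disjoint ra un′ (used⊆ra eq))
    usedQ : count used q ≡ count used b
    usedQ = trans (count-ʳ++ used b (y ∷ z ∷ []))
      (trans (cong (count used b +_) (count-none used (y ∷ z ∷ []) λ { (here refl) → used-yz (here refl)
                                                                    ; (there (here refl)) → used-yz (there (here refl)) }))
             (+-identityʳ _))
    balU : 2 * count used (b ++ u ∷ []) ≤ suc (length (b ++ u ∷ []))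
    balU = bal (b ++ u ∷ []) a (sym (++-assoc b (u ∷ []) a))
    split : ∀ {w} → w ∈ q → 1 ≤ bit (R w u) + bit (R u w)
    split {w} w∈ with tour (q⊆l (there w∈)) (q⊆l (here refl)) (All.lookup (AllPairs.head unTail) (∈-++⁺ˡ w∈) ∘ sym)
    ... | inj₁ r rewrite r = s≤s z≤n
    ... | inj₂ r rewrite r = m≤n+m 1 (bit (R w u))
    total : length q ≤ count (λ w → R w u) q + count (R u) q
    total = subst₂ _≤_ (trans (sum-map-const 1 q) (*-identityˡ _)) (sum-map-+ _ _ q)
                   (sum-map-mono (λ _ → 1) (λ w → bit (R w u) + bit (R u w)) q split)
    half : length q ≤ count (R u) q + count (R u) q
    half with dom ∷ _ ← median-ʳ++⁻ R a (subst (Median R) l≡ med) =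
      ≤-trans total (+-monoˡ-≤ (count (R u) q) (dom q rest refl))
    -- Since `u` itself is used, the balance of `b` with `u` gives `2 * count used b ≤ length b`,
    -- whereas `u` beats at least half of the `length b + 2` vertices of `q`. The two new vertices
    -- make the inequality strict.
    free : count used q < count (R u) q
    free = *-cancelˡ-< 2 _ _ (linear 1 (+-mono-≤ balU half) eq)
      where
      cb = count used b
      eq : suc (2 * count used q) + (suc (length (b ++ u ∷ [])) + (count (R u) q + count (R u) q)) + 1
         ≡ 2 * count (R u) q + (2 * count used (b ++ u ∷ []) + length q)
      eq rewrite usedQ | count-++ used b (u ∷ []) | asg⊆used (∈-map⁺ proj₂ u∈asg)
               | length-++ b {u ∷ []} | length-ʳ++ b {y ∷ z ∷ []} = arith cb (length b) (count (R u) q)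
        where
        arith : ∀ cb lb r → suc (2 * cb) + (suc (lb + 1) + (r + r)) + 1 ≡ 2 * r + (2 * (cb + (1 + 0)) + (lb + 2))
        arith = solve-∀
    Result = Σ (List (L × V)) λ asg′ → map proj₁ asg′ ↭ c ∷ map proj₂ es ++ map proj₁ asg × Unique (map proj₂ asg′) ×
      (∀ {x} → x ∈ map proj₂ asg′ → x ∈ l) × (∀ {z} → z ∈ asg → z ∈ asg′) × (∀ {e} → e ∈ (p , c) ∷ es → Joined R asg′ e)
    extend : ∀ v → v ∈ q → R u v ≡ true → used v ≡ false → Result
    extend v v∈q ruv v-unused =
      let asg′ , labels , un″ , ⊆l , ⊇ , joined = rec in
      asg′ , ↭-trans labels (shift c (map proj₂ es) (map proj₁ asg)) , un″ , ⊆l , ⊇ ∘ there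
      , λ { (here refl) → u , v , ⊇ (there u∈asg) , ⊇ (here refl) , ruv ; (there e∈) → joined e∈ }
      where
      used′ : V → Bool
      used′ w = does (w ≟ v) ∨ used w
      asg⊆ : ∀ {x} → x ∈ v ∷ map proj₂ asg → used′ x ≡ true
      asg⊆ (here refl) = cong (_∨ used v) (dec-true (v ≟ v) refl)
      asg⊆ {x} (there x∈) = trans (cong (does (x ≟ v) ∨_) (asg⊆used x∈)) (∨-zeroʳ _)
      v∈ : v ∈ z ∷ y ∷ ra
      v∈ with ∈-++⁻ b (∈-resp-↭ (↭-sym q↭) v∈q)
      ... | inj₁ v∈b = there (there (∈-++⁺ˡ v∈b))
      ... | inj₂ (here refl) = there (here refl)
      ... | inj₂ (there (here refl)) = here refl
      used⊆ : ∀ {x} → used′ x ≡ true → x ∈ z ∷ y ∷ ra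
      used⊆ {x} h with x ≟ v
      ... | yes refl = v∈
      ... | no _ = there (there (used⊆ra h))
      fresh : Unique (v ∷ map proj₂ asg)
      fresh = All.tabulate (λ { x∈ refl → contradiction (trans (sym v-unused) (asg⊆used x∈)) λ () }) ∷ unA
      -- A segment that contains both new vertices grows by two and gains at most one used vertex,
      -- which preserves the balance; shorter segments satisfy it trivially.
      bal′ : ∀ b′ c′ → z ∷ y ∷ ra ≡ b′ ++ c′ → 2 * count used′ b′ ≤ suc (length b′)
      bal′ [] c′ eq = z≤n
      bal′ (x ∷ []) c′ eq = *-monoʳ-≤ 2 (count≤length used′ (x ∷ []))
      bal′ (_ ∷ _ ∷ b′) c′ eq with refl ← ∷-injectiveˡ eq | refl ← ∷-injectiveˡ (∷-injectiveʳ eq)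
                                    | ra≡ ← ∷-injectiveʳ (∷-injectiveʳ eq) =
        linear 0 (+-mono-≤ (*-monoʳ-≤ 2 more) (bal b′ c′ ra≡))
          (arith (count used′ (z ∷ y ∷ b′)) (count used b′) (length b′))
        where
        arith : ∀ n o k → 2 * n + (2 * (1 + o) + suc k) + 0 ≡ suc (suc (suc k)) + (2 * n + 2 * o)
        arith = solve-∀
        unB : Unique (z ∷ y ∷ b′)
        unB = Unique-++ˡ (z ∷ y ∷ b′) (subst Unique eq
                (Unique-++ˡ (z ∷ y ∷ ra) (Unique-↭ (↭-sym (↭.++↭ʳ++ (z ∷ y ∷ ra) rest)) un)))
        more : count used′ (z ∷ y ∷ b′) ≤ 1 + count used b′
        more = ≤-trans (count-∨ (λ w → does (w ≟ v)) used (z ∷ y ∷ b′))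
          (+-mono-≤ (count-≟≤1 _≟_ v (z ∷ y ∷ b′) unB)
            (≤-reflexive (cong₂ (λ s t → bit s + (bit t + count used b′)) (used-yz (there (here refl))) (used-yz (here refl)))))
      rec = grow es ((c , v) ∷ asg) used′ (z ∷ y ∷ ra) rest med un tour
          (+-cancelˡ-≤ 2 (2 * length es) (length rest) (subst (_≤ suc (suc (length rest))) (*-suc 2 (length es)) len))
          asg⊆ used⊆ fresh bal′ gr
    result : Result
    result = let v , v∈q , ruv , v-unused = count-witness used (R u) q free in extend v v∈q ruv v-unused
  grow (_ ∷ es) _ _ _ [] med un tour len = contradiction len λ ()
  grow (_ ∷ es) _ _ _ (_ ∷ []) med un tour len = contradiction (subst (_≤ 1) (*-suc 2 (length es)) len) λ { (s≤s ()) }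

  -- The method of Havet and Thomassé: the first vertex of a median order takes the root, and every
  -- further vertex of the tree consumes two vertices of the order.
  tree-in-tournament : ∀ l a fs → Unique l → Tournament R l → suc (2 * length (verts fs)) ≤ length l →
    Σ (List (L × V)) λ asg → map proj₁ asg ↭ a ∷ verts fs × Unique (map proj₂ asg) ×
      (∀ {x} → x ∈ map proj₂ asg → x ∈ l) × (∀ {x y} → Edge (node a fs ∅) x y → Joined R asg (x , y))
  tree-in-tournament l a fs un tour len
    with median R (length l * length l) l (m≤m+n _ _)
  ... | [] , p , _ = contradiction (subst (suc _ ≤_) (sym (↭-length p)) len) λ ()
  ... | x ∷ rest , p , med
    with asg , labels , unA , ⊆l , _ , joined ←
      grow (pairs a fs) ((a , x) ∷ []) (λ w → does (w ≟ x)) (x ∷ []) rest med (Unique-↭ (↭-sym p) un)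
        (λ u∈ v∈ → tour (∈-resp-↭ p u∈) (∈-resp-↭ p v∈))
        (s≤s⁻¹ (subst₂ (λ s t → suc (2 * s) ≤ t) (trans (cong length (sym (map-pairs a fs))) (length-map proj₂ (pairs a fs)))
                       (sym (↭-length p)) len))
        (λ { (here refl) → dec-true (x ≟ x) refl }) (λ {y} h → here (does-true (y ≟ x) h)) ([] ∷ [])
        (λ { [] c eq → z≤n ; (y ∷ []) c eq → *-monoʳ-≤ 2 (count≤length (λ w → does (w ≟ x)) (y ∷ [])) ; (_ ∷ _ ∷ _) c () })
        (subst (Grown (a ∷ [])) (++-identityʳ _) (grown-pairs fs (here refl) (λ _ → tt)))
    = asg , ↭-trans labels (↭-trans (↭-reflexive (cong (_++ a ∷ []) (map-pairs a fs))) (↭.++-comm (verts fs) (a ∷ [])))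
    , unA , ∈-resp-↭ p ∘ ⊆l , λ { (root y∈) → joined (root⇒pair a fs y∈) ; (child e) → joined (edge⇒pair a fs e) }

-- Cells

chop : ∀ q fuel (l : List A) → length l ≤ fuel → Σ (List (List A)) λ cs → Σ (List A) λ r →
  concat cs ++ r ≡ l × All (λ c → length c ≡ suc q) cs × length r ≤ q
chop q fuel l len with length l ≤? q
... | yes short = [] , l , refl , [] , short
chop q zero l len | no long = contradiction (≤-trans len z≤n) long
chop q (suc fuel) l len | no long
  with cs , r , eq , lens , short ← chop q fuel (drop (suc q) l)
         (≤-trans (≤-reflexive (length-drop (suc q) l)) (≤-trans (∸-monoˡ-≤ (suc q) len) (m∸n≤m fuel q)))
  = take (suc q) l ∷ cs , r
  , trans (++-assoc (take (suc q) l) (concat cs) r) (trans (cong (take (suc q) l ++_) eq) (take++drop≡id (suc q) l))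
  , trans (length-take (suc q) l) (m≤n⇒m⊓n≡m (≰⇒> long)) ∷ lens , short

count≤1 : ∀ (p : A → Bool) l → Unique l → (∀ {v w} → v ∈ l → w ∈ l → p v ≡ true → p w ≡ true → v ≡ w) → count p l ≤ 1
count≤1 p [] u single = z≤n
count≤1 p (x ∷ l) (x∉ ∷ u) single with p x in px
... | false = count≤1 p l u λ v∈ w∈ → single (there v∈) (there w∈)
... | true = s≤s (≤-reflexive (count-none p l none))
  where
  none : ∀ {y} → y ∈ l → p y ≡ false
  none {y} y∈ with p y in py
  ... | false = refl
  ... | true = contradiction (single (here refl) (there y∈) px py) (All.lookup x∉ y∈)

Unique-concat⁻ : ∀ (cs : List (List A)) {c} → Unique (concat cs) → c ∈ cs → Unique c
Unique-concat⁻ (c ∷ cs) u (here refl) = Unique-++ˡ c u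
Unique-concat⁻ (c ∷ cs) u (there c∈) = Unique-concat⁻ cs (Unique-++ʳ c u) c∈

length-concat : ∀ q (cs : List (List A)) → All (λ c → length c ≡ q) cs → length (concat cs) ≡ q * length cs
length-concat q [] [] = sym (*-zeroʳ q)
length-concat q (c ∷ cs) (refl ∷ lens) =
  trans (length-++ c) (trans (cong (q +_) (length-concat q cs lens)) (sym (*-suc q (length cs))))

length-filter-count : ∀ {P : A → Set} (P? : Decidable P) xs → length (filter P? xs) ≡ count (λ x → does (P? x)) xs
length-filter-count P? [] = refl
length-filter-count P? (x ∷ xs) with P? x
... | yes _ = cong suc (length-filter-count P? xs)
... | no _ = length-filter-count P? xs

module _ {V : Set} (E : V → V → Bool) where

  -- All that the embedding keeps of the levels: with `E` blue, `inside` turns each cell into a red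
  -- tournament, and `later` bounds the blue edges that climb.
  record Cells (q : ℕ) (cs : List (List V)) : Set where
    constructor cells
    field
      size   : All (λ c → length c ≡ q) cs
      unique : Unique (concat cs)
      inside : All (λ c → ∀ {x y} → x ∈ c → y ∈ c → E x y ≡ false) cs
      later  : AllPairs (λ c c′ → ∀ {u} → u ∈ c → count (E u) c′ ≤ 1) cs

  module _ (d : V → ℕ) (q : ℕ) (U : List V) where

    levelCells : ℕ → List (List V)
    levelCells k = proj₁ (chop q (length (filter (λ v → d v ≟ k) U)) (filter (λ v → d v ≟ k) U) ≤-refl)

    cellsBelow : ℕ → List (List V)
    cellsBelow zero = []
    cellsBelow (suc k) = cellsBelow k ++ levelCells k

    level : ∀ k {v} → v ∈ concat (levelCells k) → d v ≡ k
    level k v∈ with chop q (length (filter (λ v → d v ≟ k) U)) (filter (λ v → d v ≟ k) U) ≤-refl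
    ... | cs , r , eq , _ = proj₂ (∈-filter⁻ (λ v → d v ≟ k) {xs = U} (subst (_ ∈_) eq (∈-++⁺ˡ v∈)))

    below : ∀ k {v} → v ∈ concat (cellsBelow k) → d v < k
    below (suc k) v∈ with ∈-++⁻ (concat (cellsBelow k)) (subst (_ ∈_) (sym (concat-++ (cellsBelow k) (levelCells k))) v∈)
    ... | inj₁ v∈b = m<n⇒m<1+n (below k v∈b)
    ... | inj₂ v∈l = ≤-reflexive (cong suc (level k v∈l))

    Unique-levelCells : Unique U → ∀ k → Unique (concat (levelCells k))
    Unique-levelCells uU k with chop q (length (filter (λ v → d v ≟ k) U)) (filter (λ v → d v ≟ k) U) ≤-refl
    ... | cs , r , eq , _ = Unique-++ˡ (concat cs) (subst Unique (sym eq) (Uniqueₚ.filter⁺ (λ v → d v ≟ k) uU))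

    size-levelCells : ∀ k → All (λ c → length c ≡ suc q) (levelCells k)
    size-levelCells k with chop q (length (filter (λ v → d v ≟ k) U)) (filter (λ v → d v ≟ k) U) ≤-refl
    ... | _ , _ , _ , lens , _ = lens

    Unique-cellsBelow : Unique U → ∀ k → Unique (concat (cellsBelow k))
    Unique-cellsBelow uU zero = []
    Unique-cellsBelow uU (suc k) = subst Unique (concat-++ (cellsBelow k) (levelCells k))
      (Uniqueₚ.++⁺ (Unique-cellsBelow uU k) (Unique-levelCells uU k)
        λ (v∈b , v∈l) → <-irrefl (level k v∈l) (below k v∈b))

    size-cellsBelow : ∀ k → All (λ c → length c ≡ suc q) (cellsBelow k)
    size-cellsBelow zero = []
    size-cellsBelow (suc k) = Allₚ.++⁺ (size-cellsBelow k) (size-levelCells k)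

    isLevel : ∀ k {c} → c ∈ cellsBelow k → ∃ λ h → ∀ {v} → v ∈ c → d v ≡ h
    isLevel (suc k) c∈ with ∈-++⁻ (cellsBelow k) c∈
    ... | inj₁ c∈b = isLevel k c∈b
    ... | inj₂ c∈l = k , λ v∈ → level k (∈-concat⁺′ v∈ c∈l)

    -- Weak inequality, since two cells may come from the same level; the uniqueness clause of
    -- `Levelling` also covers equal levels.
    ordered : ∀ k → AllPairs (λ c c′ → ∀ {u v} → u ∈ c → v ∈ c′ → d u ≤ d v) (cellsBelow k)
    ordered zero = []
    ordered (suc k) = AllPairsₚ.++⁺ (ordered k) (within (levelCells k) (λ c∈ v∈ → level k (∈-concat⁺′ v∈ c∈)))
      (All.tabulate λ c∈ → All.tabulate λ c′∈ u∈ v∈ →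
        ≤-trans (<⇒≤ (below k (∈-concat⁺′ u∈ c∈))) (≤-reflexive (sym (level k (∈-concat⁺′ v∈ c′∈)))))
      where
      within : ∀ cs → (∀ {c v} → c ∈ cs → v ∈ c → d v ≡ k) →
               AllPairs (λ c c′ → ∀ {u v} → u ∈ c → v ∈ c′ → d u ≤ d v) cs
      within [] lev = []
      within (c ∷ cs) lev =
        All.tabulate (λ c′∈ u∈ v∈ → ≤-reflexive (trans (lev (here refl) u∈) (sym (lev (there c′∈) v∈))))
        ∷ within cs (lev ∘ there)

    -- At most q vertices of each level are lost by cutting the level into cells of size q + 1.
    coverage : ∀ k → count (λ v → does (d v <? k)) U ≤ suc q * length (cellsBelow k) + k * q
    coverage zero = ≤-trans (≤-reflexive (count-none _ U λ {v} _ → dec-false (d v <? 0) n≮0)) z≤n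
    coverage (suc k) = begin
      count (λ v → does (d v <? suc k)) U                                  ≤⟨ split ⟩
      count (λ v → does (d v <? k)) U + count (λ v → does (d v ≟ k)) U     ≤⟨ +-mono-≤ (coverage k) top ⟩
      (suc q * length (cellsBelow k) + k * q) + (suc q * length (levelCells k) + q)
        ≡⟨ arith (suc q) (length (cellsBelow k)) k q (length (levelCells k)) ⟩
      suc q * (length (cellsBelow k) + length (levelCells k)) + suc k * q
        ≡⟨ cong (λ n → suc q * n + suc k * q) (length-++ (cellsBelow k)) ⟨
      suc q * length (cellsBelow (suc k)) + suc k * q                      ∎
      where
      open ≤-Reasoning
      arith : ∀ s a k q b → (s * a + k * q) + (s * b + q) ≡ s * (a + b) + (q + k * q)
      arith = solve-∀
      cases : ∀ {h} (a : Dec (h < suc k)) (b : Dec (h < k)) (c : Dec (h ≡ k)) → bit (does a) ≤ bit (does b) + bit (does c)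
      cases (no _) _ _ = z≤n
      cases (yes _) (yes _) _ = s≤s z≤n
      cases (yes _) (no _) (yes _) = ≤-refl
      cases (yes (s≤s lt)) (no ¬lt) (no ≢) = contradiction (≤∧≢⇒< lt ≢) ¬lt
      split : count (λ v → does (d v <? suc k)) U ≤ count (λ v → does (d v <? k)) U + count (λ v → does (d v ≟ k)) U
      split = ≤-trans (sum-map-mono _ _ U (λ {v} _ → cases (d v <? suc k) (d v <? k) (d v ≟ k))) (≤-reflexive (sum-map-+ _ _ U))
      top : count (λ v → does (d v ≟ k)) U ≤ suc q * length (levelCells k) + q
      top with chop q (length (filter (λ v → d v ≟ k) U)) (filter (λ v → d v ≟ k) U) ≤-refl
      ... | cs , r , eq , lens , short = begin
        count (λ v → does (d v ≟ k)) U     ≡⟨ length-filter-count (λ v → d v ≟ k) U ⟨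
        length (filter (λ v → d v ≟ k) U)  ≡⟨ cong length eq ⟨
        length (concat cs ++ r)            ≡⟨ length-++ (concat cs) ⟩
        length (concat cs) + length r      ≤⟨ +-mono-≤ (≤-reflexive (length-concat (suc q) cs lens)) short ⟩
        suc q * length cs + q              ∎

  levelling⇒cells : ∀ n q U → Unique U → (∀ v → v ∈ U) → Levelling E n U →
    Σ (List (List V)) λ cs → Cells (suc q) cs × length U ≤ suc q * length cs + n * q
  levelling⇒cells n q U uU full (d , d<n , apart , single) =
    cs , cells (size-cellsBelow d q U n) un
           (All.tabulate λ c∈ x∈ y∈ → let _ , lev = isLevel d q U n c∈ in ¬edge (apart (full _) (full _)) (trans (lev x∈) (sym (lev y∈))))
           (later′ cs (isLevel d q U n) (ordered d q U n) un)
    , ≤-trans (≤-reflexive (sym (count-all _ U λ v∈ → dec-true (d _ <? n) (d<n v∈)))) (coverage d q U n)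
    where
    cs = cellsBelow d q U n
    un = Unique-cellsBelow d q U uU n
    ¬edge : ∀ {x y} → (E x y ≡ true → d x ≢ d y) → d x ≡ d y → E x y ≡ false
    ¬edge {x} {y} h eq with E x y
    ... | true = contradiction eq (h refl)
    ... | false = refl
    later′ : ∀ cs → (∀ {c} → c ∈ cs → ∃ λ h → ∀ {v} → v ∈ c → d v ≡ h) →
      AllPairs (λ c c′ → ∀ {u v} → u ∈ c → v ∈ c′ → d u ≤ d v) cs → Unique (concat cs) →
      AllPairs (λ c c′ → ∀ {u} → u ∈ c → count (E u) c′ ≤ 1) cs
    later′ [] lev [] u = []
    later′ (c ∷ cs) lev (le ∷ ord) u =
      All.tabulate (λ {c′} c′∈ {x} x∈ → let _ , lv = lev (there c′∈) in
        count≤1 (E x) c′ (Unique-concat⁻ cs (Unique-++ʳ c u) c′∈) λ v∈ w∈ ev ew →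
          single (full _) (full _) (full _) ev ew (All.lookup le c′∈ x∈ v∈) (trans (lv v∈) (sym (lv w∈))))
      ∷ later′ cs (lev ∘ there) ord (Unique-++ʳ c u)

-- Cutting trees

size : Forest A → ℕ
size ∅ = 0
size (node x fs gs) = suc (size fs + size gs)

length-verts : ∀ (f : Forest A) → length (verts f) ≡ size f
length-verts ∅ = refl
length-verts (node x fs gs) = cong suc (trans (length-++ (verts fs)) (cong₂ _+_ (length-verts fs) (length-verts gs)))

-- cut x fs gs : a tree whose root x is separated from its children fs, which move on to the next level.
data CutForest (A : Set) : Set where
  ∅    : CutForest A
  keep : A → CutForest A → CutForest A → CutForest A
  cut  : A → CutForest A → CutForest A → CutForest A

forget : CutForest A → Forest A
forget ∅ = ∅
forget (keep x fs gs) = node x (forget fs) (forget gs)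
forget (cut x fs gs) = node x (forget fs) (forget gs)

top : CutForest A → Forest A
top ∅ = ∅
top (keep x fs gs) = node x (top fs) (top gs)
top (cut x fs gs) = node x ∅ (top gs)

cuts : CutForest A → List (A × CutForest A)
cuts ∅ = []
cuts (keep x fs gs) = cuts fs ++ cuts gs
cuts (cut x fs gs) = (x , fs) ∷ cuts gs

depth : CutForest A → ℕ
depth ∅ = 0
depth (keep x fs gs) = depth fs ⊔ depth gs
depth (cut x fs gs) = suc (depth fs) ⊔ depth gs

-- The inequality is strict because the kept root joins `top fs` in its piece, which then has at
-- most `τ` vertices.
Light : ℕ → CutForest A → Set
Light τ ∅ = ⊤
Light τ (keep x fs gs) = size (top fs) < τ × Light τ fs × Light τ gs
Light τ (cut x fs gs) = Light τ fs × Light τ gs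

roots-top : ∀ (f : CutForest A) → roots (top f) ≡ roots (forget f)
roots-top ∅ = refl
roots-top (keep x fs gs) = cong (x ∷_) (roots-top gs)
roots-top (cut x fs gs) = cong (x ∷_) (roots-top gs)

labels : List (CutForest A) → List A
labels fs = concat (map (verts ∘ forget) fs)

nexts : CutForest A → List (CutForest A)
nexts f = map proj₂ (cuts f)

labels-++ : ∀ (xs ys : List (CutForest A)) → labels (xs ++ ys) ≡ labels xs ++ labels ys
labels-++ xs ys = trans (cong concat (map-++ _ xs ys)) (sym (concat-++ (map _ xs) (map _ ys)))

verts-split : ∀ (f : CutForest A) → verts (forget f) ↭ verts (top f) ++ labels (nexts f)
verts-split ∅ = ↭-refl
verts-split (cut x fs gs) = prep x (↭-trans (++⁺ˡ (verts (forget fs)) (verts-split gs))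
                                            (↭.shifts (verts (forget fs)) (verts (top gs))))
verts-split (keep x fs gs) = prep x (↭-trans (++⁺ (verts-split fs) (verts-split gs)) (interchange′ (verts (top fs)) _ _ _
  (↭-reflexive (sym (trans (cong labels (map-++ proj₂ (cuts fs) (cuts gs))) (labels-++ (nexts fs) (nexts gs)))))))
  where
  interchange′ : ∀ (a b c d : List A) {e} → b ++ d ↭ e → (a ++ b) ++ (c ++ d) ↭ (a ++ c) ++ e
  interchange′ a b c d p = ↭-trans (↭-reflexive (++-assoc a b (c ++ d))) (↭-trans (++⁺ˡ a (↭-trans (↭.shifts b c) (++⁺ˡ c p)))
    (↭-reflexive (sym (++-assoc a c _))))

edge-split : ∀ (f : CutForest A) {a b} → Edge (forget f) a b →
  Edge (top f) a b ⊎ ∃ λ z → ∃ λ zs → (z , zs) ∈ cuts f × ((a ≡ z × b ∈ roots (forget zs)) ⊎ Edge (forget zs) a b)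
edge-split (keep x fs gs) (root b∈) = inj₁ (root (subst (_ ∈_) (sym (roots-top fs)) b∈))
edge-split (keep x fs gs) (child e) with edge-split fs e
... | inj₁ e′ = inj₁ (child e′)
... | inj₂ (z , zs , z∈ , r) = inj₂ (z , zs , ∈-++⁺ˡ z∈ , r)
edge-split (keep x fs gs) (sibling e) with edge-split gs e
... | inj₁ e′ = inj₁ (sibling e′)
... | inj₂ (z , zs , z∈ , r) = inj₂ (z , zs , ∈-++⁺ʳ (cuts fs) z∈ , r)
edge-split (cut x fs gs) (root b∈) = inj₂ (x , fs , here refl , inj₁ (refl , b∈))
edge-split (cut x fs gs) (child e) = inj₂ (x , fs , here refl , inj₂ e)
edge-split (cut x fs gs) (sibling e) with edge-split gs e
... | inj₁ e′ = inj₁ (sibling e′)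
... | inj₂ (z , zs , z∈ , r) = inj₂ (z , zs , there z∈ , r)

cuts⊆top : ∀ (f : CutForest A) {z zs} → (z , zs) ∈ cuts f → z ∈ verts (top f)
cuts⊆top (keep x fs gs) z∈ with ∈-++⁻ (cuts fs) z∈
... | inj₁ z∈fs = there (∈-++⁺ˡ (cuts⊆top fs z∈fs))
... | inj₂ z∈gs = there (∈-++⁺ʳ (verts (top fs)) (cuts⊆top gs z∈gs))
cuts⊆top (cut x fs gs) (here refl) = here refl
cuts⊆top (cut x fs gs) (there z∈) = there (cuts⊆top gs z∈)

cuts-light : ∀ {τ} (f : CutForest A) → Light τ f → ∀ {z zs} → (z , zs) ∈ cuts f → Light τ zs
cuts-light (keep x fs gs) (_ , lf , lg) z∈ with ∈-++⁻ (cuts fs) z∈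
... | inj₁ z∈fs = cuts-light fs lf z∈fs
... | inj₂ z∈gs = cuts-light gs lg z∈gs
cuts-light (cut x fs gs) (lf , lg) (here refl) = lf
cuts-light (cut x fs gs) (lf , lg) (there z∈) = cuts-light gs lg z∈

cuts-depth : ∀ (f : CutForest A) {z zs} → (z , zs) ∈ cuts f → depth zs < depth f
cuts-depth (keep x fs gs) z∈ with ∈-++⁻ (cuts fs) z∈
... | inj₁ z∈fs = ≤-trans (cuts-depth fs z∈fs) (m≤m⊔n _ _)
... | inj₂ z∈gs = ≤-trans (cuts-depth gs z∈gs) (m≤n⊔m (depth fs) _)
cuts-depth (cut x fs gs) (here refl) = m≤m⊔n _ (depth gs)
cuts-depth (cut x fs gs) (there z∈) = ≤-trans (cuts-depth gs z∈) (m≤n⊔m (suc (depth fs)) _)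

-- Cut as low as possible: a vertex keeps its children unless the part hanging from it would exceed τ vertices.
-- Since every cut then releases more than τ - 1 vertices, few cuts lie above each other.
cutting : ∀ τ (f : Forest A) → Σ (CutForest A) λ c →
  forget c ≡ f × Light τ c × τ * depth c + size (top c) ≤ size f
cutting τ ∅ = ∅ , refl , tt , ≤-reflexive (cong (_+ 0) (*-zeroʳ τ))
cutting τ (node x fs gs)
  with cf , refl , lf , bf ← cutting τ fs | cg , refl , lg , bg ← cutting τ gs
  with size (top cf) <? τ
-- `depth` is a maximum, but children and siblings are disjoint and each side pays for its own
-- depth, so the maximum may be replaced by the sum.
... | yes small = keep x cf cg , refl , (small , lf , lg) ,
  linear 0 (+-mono-≤ (+-mono-≤ bf bg) (*-monoʳ-≤ τ (m⊔n≤m+n (depth cf) (depth cg)))) eq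
  where
  eq : τ * (depth cf ⊔ depth cg) + size (node x (top cf) (top cg))
       + (size (forget cf) + size (forget cg) + τ * (depth cf + depth cg)) + 0
     ≡ size (node x (forget cf) (forget cg))
       + (τ * depth cf + size (top cf) + (τ * depth cg + size (top cg)) + τ * (depth cf ⊔ depth cg))
  eq = arith τ (depth cf ⊔ depth cg) (size (top cf)) (size (top cg)) (size (forget cf)) (size (forget cg)) (depth cf) (depth cg)
    where
    arith : ∀ t M a b c d e f → t * M + suc (a + b) + (c + d + t * (e + f)) + 0
                              ≡ suc (c + d) + (t * e + a + (t * f + b) + t * M)
    arith = solve-∀
... | no big = cut x cf cg , refl , (lf , lg) ,
  linear 0 (+-mono-≤ (+-mono-≤ (+-mono-≤ bf bg) (≮⇒≥ big)) (*-monoʳ-≤ τ (m⊔n≤m+n (suc (depth cf)) (depth cg)))) eq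
  where
  eq : τ * (suc (depth cf) ⊔ depth cg) + size (node x ∅ (top cg))
       + (size (forget cf) + size (forget cg) + size (top cf) + τ * (suc (depth cf) + depth cg)) + 0
     ≡ size (node x (forget cf) (forget cg))
       + (τ * depth cf + size (top cf) + (τ * depth cg + size (top cg)) + τ + τ * (suc (depth cf) ⊔ depth cg))
  eq = arith τ (suc (depth cf) ⊔ depth cg) (size (top cf)) (size (top cg)) (size (forget cf)) (size (forget cg)) (depth cf) (depth cg)
    where
    arith : ∀ t M a b c d e f → t * M + suc b + (c + d + a + t * (suc e + f)) + 0
                              ≡ suc (c + d) + (t * e + a + (t * f + b) + t + t * M)
    arith = solve-∀

-- Placing the pieces of one block

swap-left : ∀ a o b → a + o + b ≡ o + (a + b)
swap-left = solve-∀

module _ {V L : Set} (R : V → V → Bool) where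

  Attached : List (L × V) → V → L → Set
  Attached asg u b = ∃ λ v → (b , v) ∈ asg × R u v ≡ true

  joined-mono : ∀ {asg asg′ : List (L × V)} → (∀ {z} → z ∈ asg → z ∈ asg′) → ∀ {e} → Joined R asg e → Joined R asg′ e
  joined-mono ⊆ (u , v , u∈ , v∈ , r) = u , v , ⊆ u∈ , ⊆ v∈ , r

  attached-mono : ∀ {asg asg′ : List (L × V)} → (∀ {z} → z ∈ asg → z ∈ asg′) → ∀ {u b} → Attached asg u b → Attached asg′ u b
  attached-mono ⊆ (v , v∈ , r) = v , ⊆ v∈ , r

  Embeds : List (L × V) → V → Forest L → Set
  Embeds asg u f = (∀ {b} → b ∈ roots f → Attached asg u b) × (∀ {a b} → Edge f a b → Joined R asg (a , b))

  module _ (Good : V → Set) (τ κ : ℕ) where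

    -- `O` holds the occupied vertices and `κ` bounds the number of vertices that the block must
    -- host. A host of `2 * τ` vertices suffices for any piece.
    Supply : V → Set
    Supply u = ∀ O → length O < κ → Σ (List V) λ l → Unique l × Tournament R l × 2 * τ ≤ length l ×
      (∀ {v} → v ∈ l → R u v ≡ true × Good v × v ∉ O)

    -- `O` is part of the uniqueness condition so that placements can be chained: the image of one
    -- joins the occupied vertices of the next.
    record Placed (O : List V) (ls : List L) : Set where
      constructor placed
      field
        asg    : List (L × V)
        labs   : map proj₁ asg ↭ ls
        unique : Unique (map proj₂ asg ++ O)
        good   : ∀ {v} → v ∈ map proj₂ asg → Good v
    open Placed

    place-++ : ∀ {O ls ls′} (p : Placed O ls) → Placed (map proj₂ (asg p) ++ O) ls′ → Placed O (ls ++ ls′)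
    place-++ {O} p p′ = placed (asg p ++ asg p′)
      (↭-trans (↭-reflexive (map-++ proj₁ (asg p) (asg p′))) (++⁺ (labs p) (labs p′)))
      (Unique-↭ (↭-trans (↭.shifts (map proj₂ (asg p′)) (map proj₂ (asg p)))
        (↭-reflexive (trans (sym (++-assoc (map proj₂ (asg p)) _ O)) (cong (_++ O) (sym (map-++ proj₂ (asg p) (asg p′)))))))
        (unique p′))
      (λ v∈ → [ good p , good p′ ]′ (∈-++⁻ (map proj₂ (asg p)) (subst (_ ∈_) (map-++ proj₂ (asg p) (asg p′)) v∈)))

    topLabels : List (CutForest L) → List L
    topLabels fs = concat (map (verts ∘ top) fs)

    topSize : List (CutForest L) → ℕ
    topSize fs = sum (map (size ∘ top) fs)

    module _ (_≟_ : DecidableEquality V) where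

      -- Every vertex of the supplied tournament is a red out-neighbour of `u`, so the root is
      -- attached to `u` wherever the median order puts it.
      place-tree : ∀ {u} → Supply u → ∀ x fs O → Unique O → size fs < τ → length O < κ →
        Σ (Placed O (x ∷ verts fs)) λ p → Embeds (asg p) u (node x fs ∅)
      place-tree sup x fs O uO small room with l , un , tour , long , cand ← sup O room
        with asg , labs , unA , ⊆l , joined ← tree-in-tournament _≟_ R l x fs un tour
               (≤-trans (n≤1+n _) (≤-trans (≤-reflexive (sym (*-suc 2 (length (verts fs)))))
                 (≤-trans (*-monoʳ-≤ 2 (subst (_< τ) (sym (length-verts fs)) small)) long)))
        = placed asg labs (Uniqueₚ.++⁺ unA uO λ (v∈ , v∈O) → proj₂ (proj₂ (cand (⊆l v∈))) v∈O)
                 (λ v∈ → proj₁ (proj₂ (cand (⊆l v∈))))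
        , (λ { (here refl) → let (_ , v) , v∈ , eq = ∈-map⁻ proj₁ (∈-resp-↭ (↭-sym labs) (here refl)) in
                 v , subst (λ b → (b , v) ∈ asg) (sym eq) v∈ , proj₁ (cand (⊆l (∈-map⁺ proj₂ v∈))) })
        , joined

      length-placed : ∀ {O ls} (p : Placed O ls) → length (map proj₂ (asg p) ++ O) ≡ length ls + length O
      length-placed p = trans (length-++ (map proj₂ (asg p))) (cong (_+ _) (trans (length-map proj₂ (asg p))
        (trans (sym (length-map proj₁ (asg p))) (↭-length (labs p)))))

      -- Each tree asks for a fresh supply that avoids the trees before it; different trees may thus
      -- end up in different cells of the block.
      place-forest : ∀ {u} → Supply u → ∀ f → Light τ f → ∀ O → Unique O → length O + size (top f) ≤ κ → 1 ≤ τ →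
        Σ (Placed O (verts (top f))) λ p → Embeds (asg p) u (top f)
      place-forest sup ∅ lf O uO room 1≤τ = placed [] ↭-refl uO (λ ()) , (λ ()) , λ ()
      place-forest {u} sup (keep x fs gs) (small , _ , lg) O uO room 1≤τ =
        attach (place-tree sup x (top fs) O uO small (≤-trans (m<m+n _ (s≤s z≤n)) room))
        where
        attach : Σ (Placed O (x ∷ verts (top fs))) (λ p → Embeds (asg p) u (node x (top fs) ∅)) →
                 Σ (Placed O (verts (top (keep x fs gs)))) λ p → Embeds (asg p) u (top (keep x fs gs))
        attach (p , r , e) with p′ , r′ , e′ ← place-forest sup gs lg (map proj₂ (asg p) ++ O) (unique p) (≤-trans (≤-reflexive
            (trans (cong (_+ size (top gs)) (trans (length-placed p) (cong (λ n → suc n + length O) (length-verts (top fs)))))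
                   (swap-left (suc (size (top fs))) (length O) (size (top gs))))) room) 1≤τ
          = place-++ p p′
          , (λ { (here refl) → attached-mono ∈-++⁺ˡ (r (here refl)) ; (there b∈) → attached-mono (∈-++⁺ʳ (asg p)) (r′ b∈) })
          , λ { (root b∈) → joined-mono ∈-++⁺ˡ (e (root b∈)) ; (child ed) → joined-mono ∈-++⁺ˡ (e (child ed))
              ; (sibling ed) → joined-mono (∈-++⁺ʳ (asg p)) (e′ ed) }
      place-forest {u} sup (cut x fs gs) (_ , lg) O uO room 1≤τ =
        attach (place-tree sup x ∅ O uO 1≤τ (≤-trans (m<m+n _ (s≤s z≤n)) room))
        where
        attach : Σ (Placed O (x ∷ [])) (λ p → Embeds (asg p) u (node x ∅ ∅)) →
                 Σ (Placed O (verts (top (cut x fs gs)))) λ p → Embeds (asg p) u (top (cut x fs gs))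
        attach (p , r , e) with p′ , r′ , e′ ← place-forest sup gs lg (map proj₂ (asg p) ++ O) (unique p)
                 (≤-trans (≤-reflexive (trans (cong (_+ size (top gs)) (length-placed p)) (sym (+-suc (length O) (size (top gs)))))) room) 1≤τ
          = place-++ p p′
          , (λ { (here refl) → attached-mono ∈-++⁺ˡ (r (here refl)) ; (there b∈) → attached-mono (∈-++⁺ʳ (asg p)) (r′ b∈) })
          , λ { (root b∈) → joined-mono ∈-++⁺ˡ (e (root b∈)) ; (child ed) → joined-mono ∈-++⁺ˡ (e (child ed))
              ; (sibling ed) → joined-mono (∈-++⁺ʳ (asg p)) (e′ ed) }

      place-all : ∀ (P : List (V × CutForest L)) → (∀ {u f} → (u , f) ∈ P → Supply u × Light τ f) → ∀ O → Unique O →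
        length O + topSize (map proj₂ P) ≤ κ → 1 ≤ τ →
        Σ (Placed O (topLabels (map proj₂ P))) λ p → ∀ {u f} → (u , f) ∈ P → Embeds (asg p) u (top f)
      place-all [] sup O uO room 1≤τ = placed [] ↭-refl uO (λ ()) , λ ()
      place-all ((u , f) ∷ P) sup O uO room 1≤τ =
        attach (place-forest (proj₁ (sup (here refl))) f (proj₂ (sup (here refl))) O uO (≤-trans (+-monoʳ-≤ (length O) (m≤m+n _ _)) room) 1≤τ)
        where
        attach : Σ (Placed O (verts (top f))) (λ p → Embeds (asg p) u (top f)) →
                 Σ (Placed O (topLabels (f ∷ map proj₂ P))) λ p → ∀ {u′ f′} → (u′ , f′) ∈ (u , f) ∷ P → Embeds (asg p) u′ (top f′)
        attach (p , em) with p′ , em′ ← place-all P (sup ∘ there) (map proj₂ (asg p) ++ O) (unique p) (≤-trans (≤-reflexive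
            (trans (cong (_+ topSize (map proj₂ P)) (trans (length-placed p) (cong (_+ length O) (length-verts (top f)))))
                   (swap-left (size (top f)) (length O) (topSize (map proj₂ P))))) room) 1≤τ
          = place-++ p p′
          , λ { (here refl) → attached-mono ∈-++⁺ˡ ∘ proj₁ em , joined-mono ∈-++⁺ˡ ∘ proj₂ em
              ; (there q∈) → attached-mono (∈-++⁺ʳ (asg p)) ∘ proj₁ (em′ q∈) , joined-mono (∈-++⁺ʳ (asg p)) ∘ proj₂ (em′ q∈) }

-- Joining a block with the levels below it

allCuts : List (CutForest A) → List (A × CutForest A)
allCuts fs = concat (map cuts fs)

labels-split : ∀ (fs : List (CutForest A)) → labels fs ↭ concat (map (verts ∘ top) fs) ++ labels (map proj₂ (allCuts fs))
labels-split [] = ↭-refl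
labels-split (f ∷ fs) = ↭-trans (++⁺ (verts-split f) (labels-split fs))
  (↭-trans (↭-reflexive (++-assoc (verts (top f)) _ _)) (↭-trans (++⁺ˡ (verts (top f)) (↭.shifts (labels (nexts f)) tops))
    (↭-trans (↭-reflexive (sym (++-assoc (verts (top f)) tops _)))
      (↭-reflexive (cong ((verts (top f) ++ tops) ++_)
        (sym (trans (cong labels (map-++ proj₂ (cuts f) (allCuts fs))) (labels-++ (nexts f) _))))))))
  where
  tops = concat (map (verts ∘ top) fs)

cuts⊆tops : ∀ (fs : List (CutForest A)) {z g} → (z , g) ∈ allCuts fs → z ∈ concat (map (verts ∘ top) fs)
cuts⊆tops (f ∷ fs) z∈ with ∈-++⁻ (cuts f) z∈
... | inj₁ z∈f = ∈-++⁺ˡ (cuts⊆top f z∈f)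
... | inj₂ z∈fs = ∈-++⁺ʳ (verts (top f)) (cuts⊆tops fs z∈fs)

∈-allCuts⁻ : ∀ (fs : List (CutForest A)) {c} → c ∈ allCuts fs → ∃ λ f → f ∈ fs × c ∈ cuts f
∈-allCuts⁻ (f ∷ fs) c∈ with ∈-++⁻ (cuts f) c∈
... | inj₁ c∈f = f , here refl , c∈f
... | inj₂ c∈fs = let g , g∈ , c∈g = ∈-allCuts⁻ fs c∈fs in g , there g∈ , c∈g

∈-allCuts⁺ : ∀ (fs : List (CutForest A)) {f c} → f ∈ fs → c ∈ cuts f → c ∈ allCuts fs
∈-allCuts⁺ (f ∷ fs) (here refl) c∈ = ∈-++⁺ˡ c∈
∈-allCuts⁺ (f ∷ fs) (there f∈) c∈ = ∈-++⁺ʳ (cuts f) (∈-allCuts⁺ fs f∈ c∈)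

module _ {V L : Set} (R : V → V → Bool) where

  Outcome : List (V × CutForest L) → List V → Set
  Outcome P S = Σ (List (L × V)) λ asg → map proj₁ asg ↭ labels (map proj₂ P) × Unique (map proj₂ asg) ×
    (∀ {v} → v ∈ map proj₂ asg → v ∈ S) × (∀ {u f} → (u , f) ∈ P → Embeds R asg u (forget f))

  -- `P` is `cs` with every cut vertex replaced by its image. The forests agree as lists, and not
  -- only as sets, because the room they need is a sum over the list.
  Pending : List (L × V) → List (L × CutForest L) → List (V × CutForest L) → Set
  Pending asg cs P = map proj₂ P ≡ map proj₂ cs ×
    (∀ {x f} → (x , f) ∈ P → x ∈ map proj₂ asg × ∃ λ z → (z , f) ∈ cs) ×
    (∀ {z f} → (z , f) ∈ cs → ∃ λ x → (z , x) ∈ asg × (x , f) ∈ P)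

  pending : ∀ asg cs → (∀ {z f} → (z , f) ∈ cs → z ∈ map proj₁ asg) → Σ _ (Pending asg cs)
  pending asg [] h = [] , refl , (λ ()) , λ ()
  pending asg ((z , f) ∷ cs) h with (_ , x) , x∈ , refl ← ∈-map⁻ proj₁ (h (here refl))
                                  | P , eq , from , to ← pending asg cs (h ∘ there) =
    (x , f) ∷ P , cong (f ∷_) eq
    , (λ { (here refl) → ∈-map⁺ proj₂ x∈ , z , here refl
         ; (there p∈) → let x∈ , z , z∈ = from p∈ in x∈ , z , there z∈ })
    , λ { (here refl) → x , x∈ , here refl ; (there c∈) → let x , x∈ , p∈ = to c∈ in x , x∈ , there p∈ }

  pending-[] : ∀ asg cs → (∀ {c} → c ∈ cs → ⊥) → Pending asg cs []
  pending-[] asg [] h = refl , (λ ()) , λ ()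
  pending-[] asg (c ∷ cs) h with () ← h (here refl)

  -- An edge of a pending forest lies in its top part, or below a cut, or leads from a cut vertex to
  -- a root below it. The last kind is red because the lower forest was embedded as attached to the
  -- image of that cut vertex.
  combine : ∀ {Good : V → Set} {τ κ S S′} P →
    (p : Placed R Good τ κ [] (topLabels R Good τ κ (map proj₂ P))) →
    (∀ {u f} → (u , f) ∈ P → Embeds R (Placed.asg p) u (top f)) →
    ∀ P′ → Pending (Placed.asg p) (allCuts (map proj₂ P)) P′ → Outcome P′ S′ →
    (∀ {v} → Good v → v ∈ S) → (∀ {v} → v ∈ S → v ∈ S′ → ⊥) → Outcome P (S ++ S′)
  combine {S = S} P p em P′ (eq , from , to) (asg′ , labs′ , un′ , ⊆S′ , em′) good⊆S disj =
    asg ++ asg′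
    , ↭-trans (↭-reflexive (map-++ proj₁ asg asg′)) (↭-trans (++⁺ (Placed.labs p) (↭-trans labs′ (↭-reflexive (cong labels eq))))
        (↭-sym (labels-split (map proj₂ P))))
    , subst Unique (sym (map-++ proj₂ asg asg′)) (Uniqueₚ.++⁺ (subst Unique (++-identityʳ _) (Placed.unique p)) un′
        λ (v∈ , v∈′) → disj (good⊆S (Placed.good p v∈)) (⊆S′ v∈′))
    , (λ v∈ → [ ∈-++⁺ˡ ∘ good⊆S ∘ Placed.good p , ∈-++⁺ʳ S ∘ ⊆S′ ]′
                (∈-++⁻ (map proj₂ asg) (subst (_ ∈_) (map-++ proj₂ asg asg′) v∈)))
    , λ {u} {f} uf∈ → (λ b∈ → attached-mono R ∈-++⁺ˡ (proj₁ (em uf∈) (subst (_ ∈_) (sym (roots-top f)) b∈)))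
                    , λ e → edges uf∈ (edge-split f e)
    where
    asg = Placed.asg p
    edges : ∀ {u f a b} → (u , f) ∈ P →
      Edge (top f) a b ⊎ (∃ λ z → ∃ λ zs → (z , zs) ∈ cuts f × ((a ≡ z × b ∈ roots (forget zs)) ⊎ Edge (forget zs) a b)) →
      Joined R (asg ++ asg′) (a , b)
    edges uf∈ (inj₁ e) = joined-mono R ∈-++⁺ˡ (proj₂ (em uf∈) e)
    edges uf∈ (inj₂ (z , zs , z∈ , r)) with to (∈-allCuts⁺ (map proj₂ P) (∈-map⁺ proj₂ uf∈) z∈) | r
    ... | x , x∈ , xzs∈ | inj₂ e = joined-mono R (∈-++⁺ʳ asg) (proj₂ (em′ xzs∈) e)
    ... | x , x∈ , xzs∈ | inj₁ (refl , b∈) =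
      let v , v∈ , xv = proj₁ (em′ xzs∈) b∈ in x , v , ∈-++⁺ˡ x∈ , ∈-++⁺ʳ asg v∈ , xv

-- Embedding block by block

AllPairs-++⁻ : ∀ {R : A → A → Set} xs {ys} → AllPairs R (xs ++ ys) →
  AllPairs R xs × AllPairs R ys × (∀ {x y} → x ∈ xs → y ∈ ys → R x y)
AllPairs-++⁻ [] ps = [] , ps , λ ()
AllPairs-++⁻ (x ∷ xs) (p ∷ ps) = let l , r , c = AllPairs-++⁻ xs ps in
  Allₚ.++⁻ˡ xs p ∷ l , r , λ { (here refl) y∈ → All.lookup (Allₚ.++⁻ʳ xs p) y∈ ; (there x∈) y∈ → c x∈ y∈ }

cells-++⁻ : ∀ {V : Set} {E : V → V → Bool} {q} xs {ys} → Cells E q (xs ++ ys) →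
  Cells E q xs × Cells E q ys × (∀ {c c′} → c ∈ xs → c′ ∈ ys → ∀ {u} → u ∈ c → count (E u) c′ ≤ 1)
cells-++⁻ xs {ys} (cells sz un ins lat) =
  cells (Allₚ.++⁻ˡ xs sz) (Unique-++ˡ (concat xs) un′) (Allₚ.++⁻ˡ xs ins) (proj₁ lat′)
  , cells (Allₚ.++⁻ʳ xs sz) (Unique-++ʳ (concat xs) un′) (Allₚ.++⁻ʳ xs ins) (proj₁ (proj₂ lat′))
  , proj₂ (proj₂ lat′)
  where
  un′ = subst Unique (sym (concat-++ xs ys)) un
  lat′ = AllPairs-++⁻ xs lat

ceiling : ∀ τ x → 1 ≤ τ → Σ ℕ λ μ → x ≤ τ * μ × τ * μ ≤ x + τ
ceiling τ zero 1≤τ = 0 , z≤n , ≤-trans (≤-reflexive (*-zeroʳ τ)) z≤n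
ceiling τ (suc x) 1≤τ with μ , lo , hi ← ceiling τ x 1≤τ | suc x ≤? τ * μ
... | yes lo′ = μ , lo′ , m≤n⇒m≤1+n hi
... | no ¬lo′ = suc μ
  , ≤-trans (≤-trans (≤-reflexive (+-comm 1 x)) (+-mono-≤ lo 1≤τ)) (≤-reflexive (trans (+-comm (τ * μ) τ) (sym (*-suc τ μ))))
  , ≤-trans (≤-reflexive (trans (*-suc τ μ) (+-comm τ (τ * μ)))) (+-monoˡ-≤ τ (<⇒≤ (≰⇒> ¬lo′)))

-- One of the `suc δ` shares `k + τ`, together with the `κ` vertices of the next block, pays for its
-- `μ` cells; `rest-fits` passes on what remains.
block-fits : ∀ κ k τ μ δ l m r → l ≡ κ + m → τ * μ ≤ κ + k + τ → (k + τ) * suc δ + l ≤ τ * r → τ * μ ≤ τ * r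
block-fits κ k τ μ δ _ m r refl hi more = ≤-trans hi (≤-trans (m≤m+n _ (k * δ + τ * δ + m)) (≤-trans (≤-reflexive (eq κ k τ δ m)) more))
  where
  eq : ∀ κ k t δ m → κ + k + t + (k * δ + t * δ + m) ≡ (k + t) * suc δ + (κ + m)
  eq = solve-∀

rest-fits : ∀ κ k τ μ δ l m r → l ≡ κ + m → τ * μ ≤ κ + k + τ → (k + τ) * suc δ + l ≤ τ * (μ + r) → (k + τ) * δ + m ≤ τ * r
rest-fits κ k τ μ δ _ m r refl hi more = linear 0 (+-mono-≤ hi more) (eq κ k τ μ δ m r)
  where
  eq : ∀ κ k t μ δ m r → (k + t) * δ + m + (κ + k + t + t * (μ + r)) + 0 ≡ t * r + (t * μ + ((k + t) * suc δ + (κ + m)))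
  eq = solve-∀

module _ {V L : Set} (_≟_ : DecidableEquality V) (Rd Bl : V → V → Bool) where

  open import Data.List.Membership.DecPropositional _≟_ using (_∈?_)

  count-∈≤length : ∀ O xs → Unique xs → count (λ v → does (v ∈? O)) xs ≤ length O
  count-∈≤length [] xs un = ≤-reflexive (count-none _ xs λ _ → refl)
  count-∈≤length (o ∷ O) xs un = ≤-trans (sum-map-mono _ (λ v → bit (does (v ≟ o) ∨ does (v ∈? O))) xs (λ {v} _ → ≤-reflexive (step v)))
    (≤-trans (count-∨ (λ v → does (v ≟ o)) (λ v → does (v ∈? O)) xs) (+-mono-≤ (count-≟≤1 _≟_ o xs un) (count-∈≤length O xs un)))
    where
    step : ∀ v → bit (does (v ∈? (o ∷ O))) ≡ bit (does (v ≟ o) ∨ does (v ∈? O))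
    step v with v ≟ o | v ∈? O
    ... | yes _ | yes _ = refl
    ... | yes _ | no _ = refl
    ... | no _ | yes _ = refl
    ... | no _ | no _ = refl

  module Embedding
           (complete : ∀ {x y} → x ≢ y → (Rd x y ≡ true ⊎ Rd y x ≡ true) ⊎ (Bl x y ≡ true ⊎ Bl y x ≡ true))
           (e τ k : ℕ) (1≤e : 1 ≤ e) (1≤τ : 1 ≤ τ)
           (pseudorandom : ∀ X Y → Unique (X ++ Y) → k ≤ length X → k ≤ length Y →
              length X * length Y ≤ e * sum (map (λ x → count (λ y → Rd x y ∨ Bl x y) Y) X)) where

    -- The threshold for pseudorandomness: out-degrees below `3 * τ` red and at most one blue edge
    -- per cell give a density below `1 / e`.
    q : ℕ
    q = e * (3 * τ + 1)

    Rich : List (List V) → V → Set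
    Rich cs u = 3 * τ * length cs ≤ count (Rd u) (concat cs)

    clique : ∀ {c} → (∀ {x y} → x ∈ c → y ∈ c → Bl x y ≡ false) → Tournament Rd c
    clique ins x∈ y∈ x≢y with complete x≢y
    ... | inj₁ r = r
    ... | inj₂ (inj₁ b) = contradiction (trans (sym b) (ins x∈ y∈)) true≢false
    ... | inj₂ (inj₂ b) = contradiction (trans (sym b) (ins y∈ x∈)) true≢false

    -- Bad and occupied vertices together number less than `τ * length cs`. So more than
    -- `2 * τ * length cs` red out-neighbours are usable, and some cell contains more than `2 * τ`
    -- of them; inside it all edges are red.
    supply : ∀ {cs u κ} → Cells Bl q cs → Rich cs u → ∀ (bad : V → Bool) → count bad (concat cs) ≤ k → κ + k ≤ τ * length cs →
      Supply {L = L} Rd (λ v → v ∈ concat cs × bad v ≡ false) τ κ u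
    supply {cs} {u} {κ} (cells sz un ins lat) rich bad fewBad room O O<κ =
      pick (average (count Z) (2 * τ) cs (≤-trans many (≤-reflexive (sum-map-concat (bit ∘ Z) cs))))
      where
      Z : V → Bool
      Z v = Rd u v ∧ not (bad v ∨ does (v ∈? O))
      pointwise : ∀ a b c → bit a ≤ bit (a ∧ not (b ∨ c)) + (bit b + bit c)
      pointwise false b c = z≤n
      pointwise true true c = s≤s z≤n
      pointwise true false true = s≤s z≤n
      pointwise true false false = s≤s z≤n
      split : count (Rd u) (concat cs) ≤ count Z (concat cs) + (count bad (concat cs) + count (λ v → does (v ∈? O)) (concat cs))
      split = ≤-trans (sum-map-mono _ (λ v → bit (Z v) + (bit (bad v) + bit (does (v ∈? O)))) (concat cs)
                        (λ {v} _ → pointwise (Rd u v) (bad v) (does (v ∈? O))))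
        (≤-reflexive (trans (sum-map-+ _ _ (concat cs)) (cong (count Z (concat cs) +_) (sum-map-+ _ _ (concat cs)))))
      many : 2 * τ * length cs < count Z (concat cs)
      many = linear 0 (+-mono-≤ (+-mono-≤ (+-mono-≤ (+-mono-≤ (+-mono-≤ split rich) fewBad) (count-∈≤length O (concat cs) un)) O<κ) room)
        (arith τ (length cs) (count Z (concat cs)) (count bad (concat cs)) (count (λ v → does (v ∈? O)) (concat cs))
               (count (Rd u) (concat cs)) k (length O) κ)
        where
        arith : ∀ t m z b o r k l κ → suc (2 * t * m) + (z + (b + o) + r + k + l + κ + t * m) + 0
                                    ≡ z + (r + 3 * t * m + b + o + suc l + (κ + k))
        arith = solve-∀
      pick : (Σ (List V) λ c → c ∈ cs × 2 * τ < count Z c) → Σ (List V) λ l → Unique l × Tournament Rd l × 2 * τ ≤ length l ×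
        (∀ {v} → v ∈ l → Rd u v ≡ true × (v ∈ concat cs × bad v ≡ false) × v ∉ O)
      pick (c , c∈ , lt) = filter (T? ∘ Z) c , Uniqueₚ.filter⁺ (T? ∘ Z) (Unique-concat⁻ cs un c∈)
        , (λ x∈ y∈ → clique (All.lookup ins c∈) (proj₁ (∈-filter⁻ (T? ∘ Z) {xs = c} x∈)) (proj₁ (∈-filter⁻ (T? ∘ Z) {xs = c} y∈)))
        , ≤-trans (<⇒≤ lt) (≤-reflexive (sym (length-filter-count (T? ∘ Z) c)))
        , λ {v} v∈ → let v∈c , z = ∈-filter⁻ (T? ∘ Z) {xs = c} v∈ in props v (∈-concat⁺′ v∈c c∈) z
        where
        props : ∀ v → v ∈ concat cs → T (Z v) → Rd u v ≡ true × (v ∈ concat cs × bad v ≡ false) × v ∉ O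
        props v v∈ z with Rd u v | bad v | v ∈? O
        ... | true | false | no v∉O = refl , (v∈ , refl) , v∉O

    poor : List (List V) → V → Bool
    poor cs v = does (count (Rd v) (concat cs) <? 3 * τ * length cs)

    -- More than `k` poor vertices would form a set `X` to which pseudorandomness applies. But each
    -- of them sends fewer than `(3 * τ + 1) * length cs′` edges to the next block, which is its
    -- size divided by `e`.
    few-poor : ∀ cs cs′ → Cells Bl q (cs ++ cs′) → k ≤ q * length cs′ → count (poor cs′) (concat cs) ≤ k
    few-poor cs cs′ cl large = ≮⇒≥ λ many → contradiction
      (*-cancelˡ-≤ e {{>-nonZero 1≤e}} (≤-trans (*-monoʳ-≤ e rows) (≤-trans (≤-reflexive rescale) (≤-trans (pseudorandom X Y unXY
           (≤-trans (<⇒≤ many) (≤-reflexive (sym lenX))) (≤-trans large (≤-reflexive (sym lenY)))) ≤-refl))))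
      (<⇒≱ (m<m+n edges (≤-<-trans z≤n (<-≤-trans many (≤-reflexive (sym lenX))))))
      where
      cl₁ = proj₁ (cells-++⁻ cs cl)
      cl₂ = proj₁ (proj₂ (cells-++⁻ cs cl))
      cross = proj₂ (proj₂ (cells-++⁻ cs cl))
      X = filter (λ v → count (Rd v) (concat cs′) <? 3 * τ * length cs′) (concat cs)
      Y = concat cs′
      edges = sum (map (λ x → count (λ y → Rd x y ∨ Bl x y) Y) X)
      lenX : length X ≡ count (poor cs′) (concat cs)
      lenX = length-filter-count (λ v → count (Rd v) (concat cs′) <? 3 * τ * length cs′) (concat cs)
      lenY : length Y ≡ q * length cs′
      lenY = length-concat q cs′ (Cells.size cl₂)
      unXY : Unique (X ++ Y)
      unXY = Uniqueₚ.++⁺ (Uniqueₚ.filter⁺ _ (Cells.unique cl₁)) (Cells.unique cl₂)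
        λ (x∈ , y∈) → Unique-++-disjoint (concat cs) (subst Unique (sym (concat-++ cs cs′)) (Cells.unique cl))
                        (proj₁ (∈-filter⁻ _ {xs = concat cs} x∈)) y∈
      fewBlue : ∀ {x} → x ∈ concat cs → count (Bl x) Y ≤ length cs′
      fewBlue {x} x∈ with c , x∈c , c∈ ← ∈-concat⁻′ cs x∈ =
        ≤-trans (≤-reflexive (sum-map-concat (bit ∘ Bl x) cs′))
          (≤-trans (sum-map-mono _ (λ _ → 1) cs′ (λ c′∈ → cross c∈ c′∈ x∈c)) (≤-reflexive (trans (sum-map-const 1 cs′) (*-identityˡ _))))
      -- The extra 1 comes from the strict inequality for poor vertices; summed over the nonempty
      -- set `X` it produces the contradiction.
      row : ∀ {x} → x ∈ X → count (λ y → Rd x y ∨ Bl x y) Y + 1 ≤ (3 * τ + 1) * length cs′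
      row {x} x∈ with x∈cs , lt ← ∈-filter⁻ (λ v → count (Rd v) (concat cs′) <? 3 * τ * length cs′) {xs = concat cs} x∈ =
        linear 0 (+-mono-≤ (+-mono-≤ (count-∨ (Rd x) (Bl x) Y) (fewBlue x∈cs)) lt)
          (arith (count (λ y → Rd x y ∨ Bl x y) Y) (count (Rd x) Y) (count (Bl x) Y) (length cs′) τ)
        where
        arith : ∀ c r b m t → c + 1 + (r + b + m + 3 * t * m) + 0 ≡ (3 * t + 1) * m + (c + b + suc r)
        arith = solve-∀
      rows : edges + length X ≤ (3 * τ + 1) * length cs′ * length X
      rows = ≤-trans (≤-reflexive (trans (cong (edges +_) (sym (trans (sum-map-const 1 X) (*-identityˡ _)))) (sym (sum-map-+ _ _ X))))
        (≤-trans (sum-map-mono _ (λ _ → (3 * τ + 1) * length cs′) X row) (≤-reflexive (sum-map-const _ X)))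
      rescale : e * ((3 * τ + 1) * length cs′ * length X) ≡ length X * length Y
      rescale = trans (arith e (3 * τ + 1) (length cs′) (length X)) (cong (length X *_) (sym lenY))
        where
        arith : ∀ e s m x → e * (s * m * x) ≡ x * (e * s * m)
        arith = solve-∀

    τ≤q : τ ≤ q
    τ≤q = ≤-trans (≤-trans (m≤n*m τ 3) (m≤m+n (3 * τ) 1)) (m≤n*m (3 * τ + 1) e {{>-nonZero 1≤e}})

    -- The block cs hosts the parts of the pending trees above their first cuts, rest everything below.
    topWeight : List (CutForest L) → ℕ
    topWeight fs = sum (map (size ∘ top) fs)

    lowers : List (CutForest L) → List (CutForest L)
    lowers fs = map proj₂ (allCuts fs)

    -- Each of the `δ` blocks still to be cut from `rest` costs, beyond the vertices it hosts, `k`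
    -- for its poor vertices and at most `τ` for rounding up to whole cells.
    LevelsEmbed : ℕ → Set
    LevelsEmbed δ = ∀ (P : List (V × CutForest L)) cs rest → Cells Bl q (cs ++ rest) →
      (∀ {u f} → (u , f) ∈ P → Rich cs u × Light τ f × depth f ≤ δ) →
      topWeight (map proj₂ P) + k ≤ τ * length cs →
      (k + τ) * δ + length (labels (lowers (map proj₂ P))) ≤ τ * length rest →
      Outcome Rd P (concat cs ++ concat rest)

    module Block (P : List (V × CutForest L)) (cs rest : List (List V)) (cl : Cells Bl q (cs ++ rest))
                 (room : topWeight (map proj₂ P) + k ≤ τ * length cs) where

      Fs = map proj₂ P
      C = allCuts Fs

      BlockPlaced : (V → Bool) → Set
      BlockPlaced bad = Placed Rd (λ v → v ∈ concat cs × bad v ≡ false) τ (topWeight Fs) [] (concat (map (verts ∘ top) Fs))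

      disjoint : ∀ {v} → v ∈ concat cs → v ∈ concat rest → ⊥
      disjoint = Unique-++-disjoint (concat cs) (subst Unique (sym (concat-++ cs rest)) (Cells.unique cl))

      fill : (bad : V → Bool) → count bad (concat cs) ≤ k → (∀ {u f} → (u , f) ∈ P → Rich cs u × Light τ f) →
        Σ (BlockPlaced bad) λ p → ∀ {u f} → (u , f) ∈ P → Embeds Rd (Placed.asg p) u (top f)
      fill bad few ok = place-all Rd (λ v → v ∈ concat cs × bad v ≡ false) τ _ _≟_ P
        (λ uf∈ → supply (proj₁ (cells-++⁻ cs cl)) (proj₁ (ok uf∈)) bad few room , proj₂ (ok uf∈)) [] [] ≤-refl 1≤τ

      cut-origin : ∀ {z g} → (z , g) ∈ C → ∃ λ u → ∃ λ f → (u , f) ∈ P × (z , g) ∈ cuts f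
      cut-origin c∈ with f , f∈ , c∈f ← ∈-allCuts⁻ Fs c∈ with (u , _) , uf∈ , refl ← ∈-map⁻ proj₂ f∈ = u , f , uf∈ , c∈f

    -- At depth 0 nothing is cut off, so no image has to be rich towards a later block and no vertex
    -- counts as bad.
    embed-last : LevelsEmbed 0
    embed-last P cs rest cl ok room _ = finish (fill (λ _ → false) (≤-trans (≤-reflexive (count-none (λ _ → false) (concat cs) λ _ → refl)) z≤n)
                                              (λ uf∈ → proj₁ (ok uf∈) , proj₁ (proj₂ (ok uf∈))))
      where
      open Block P cs rest cl room
      noCuts : ∀ {c} → c ∈ C → ⊥
      noCuts c∈ with u , f , uf∈ , c∈f ← cut-origin c∈ =
        contradiction (<-≤-trans (cuts-depth f c∈f) (proj₂ (proj₂ (ok uf∈)))) n≮0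
      finish : (Σ (BlockPlaced (λ _ → false)) λ p → ∀ {u f} → (u , f) ∈ P → Embeds Rd (Placed.asg p) u (top f)) →
        Outcome Rd P (concat cs ++ concat rest)
      finish (p , em) = combine Rd P p em [] (pending-[] Rd (Placed.asg p) C noCuts) ([] , ↭-refl , [] , (λ ()) , λ ()) proj₁ disjoint

    labels-below : ∀ fs → length (labels fs) ≡ topWeight fs + length (labels (lowers fs))
    labels-below fs = trans (↭-length (labels-split fs)) (trans (length-++ (concat (map (verts ∘ top) fs)))
      (cong (_+ length (labels (lowers fs))) (tops fs)))
      where
      tops : ∀ fs → length (concat (map (verts ∘ top) fs)) ≡ topWeight fs
      tops [] = refl
      tops (f ∷ fs) = trans (length-++ (verts (top f))) (cong₂ _+_ (length-verts (top f)) (tops fs))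

    rich : ∀ cs x → poor cs x ≡ false → Rich cs x
    rich cs x h = ≮⇒≥ λ lt →
      true≢false (trans (sym (dec-true (count (Rd x) (concat cs) <? 3 * τ * length cs) lt)) h)

    -- The vertices that are poor towards `cs′` are declared bad for the whole block `cs`. Hence
    -- whichever vertex becomes the image of a cut vertex, it is rich towards `cs′`, as the
    -- induction requires.
    embed-next : ∀ δ → LevelsEmbed δ → ∀ P cs cs′ rest → Cells Bl q (cs ++ (cs′ ++ rest)) →
      (∀ {u f} → (u , f) ∈ P → Rich cs u × Light τ f × depth f ≤ suc δ) →
      topWeight (map proj₂ P) + k ≤ τ * length cs →
      topWeight (lowers (map proj₂ P)) + k ≤ τ * length cs′ →
      (k + τ) * δ + length (labels (lowers (lowers (map proj₂ P)))) ≤ τ * length rest →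
      Outcome Rd P (concat cs ++ concat (cs′ ++ rest))
    embed-next δ rec P cs cs′ rest cl ok room room′ more = hang (fill (poor cs′)
      (few-poor cs cs′ (proj₁ (cells-++⁻ (cs ++ cs′) (subst (Cells Bl q) (sym (++-assoc cs cs′ rest)) cl)))
        (≤-trans (m≤n+m k _) (≤-trans room′ (*-monoˡ-≤ (length cs′) τ≤q))))
      (λ uf∈ → proj₁ (ok uf∈) , proj₁ (proj₂ (ok uf∈))))
      where
      open Block P cs (cs′ ++ rest) cl room
      below-ok : ∀ {z f} → (z , f) ∈ C → Light τ f × depth f ≤ δ
      below-ok c∈ with u , f , uf∈ , c∈f ← cut-origin c∈ =
        cuts-light f (proj₁ (proj₂ (ok uf∈))) c∈f , s≤s⁻¹ (<-≤-trans (cuts-depth f c∈f) (proj₂ (proj₂ (ok uf∈))))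
      lower : (p : BlockPlaced (poor cs′)) → ∀ P′ → Pending Rd (Placed.asg p) C P′ → Outcome Rd P′ (concat (cs′ ++ rest))
      lower p P′ (eq , from , _) = subst (Outcome Rd P′) (concat-++ cs′ rest) (rec P′ cs′ rest (proj₁ (proj₂ (cells-++⁻ cs cl)))
        (λ {x} xf∈ → rich cs′ x (proj₂ (Placed.good p (proj₁ (from xf∈)))) , below-ok (proj₂ (proj₂ (from xf∈))))
        (subst (λ fs → topWeight fs + k ≤ τ * length cs′) (sym eq) room′)
        (subst (λ fs → (k + τ) * δ + length (labels (lowers fs)) ≤ τ * length rest) (sym eq) more))
      hang : (Σ (BlockPlaced (poor cs′)) λ p → ∀ {u f} → (u , f) ∈ P → Embeds Rd (Placed.asg p) u (top f)) →
        Outcome Rd P (concat cs ++ concat (cs′ ++ rest))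
      hang (p , em) with P′ , pend ← pending Rd (Placed.asg p) C (λ z∈ → ∈-resp-↭ (↭-sym (Placed.labs p)) (cuts⊆tops Fs z∈)) =
        combine Rd P p em P′ pend (lower p P′ pend) proj₁ disjoint

    embed-levels : ∀ δ → LevelsEmbed δ
    embed-levels zero = embed-last
    embed-levels (suc δ) P cs rest cl ok room more
      with μ , lo , hi ← ceiling τ (topWeight (lowers (map proj₂ P)) + k) 1≤τ =
      subst (λ r → Outcome Rd P (concat cs ++ concat r)) (take++drop≡id μ rest)
        (embed-next δ (embed-levels δ) P cs (take μ rest) (drop μ rest) (subst (λ r → Cells Bl q (cs ++ r)) (sym (take++drop≡id μ rest)) cl)
          ok room (subst (λ n → topWeight (lowers (map proj₂ P)) + k ≤ τ * n) (sym len′) lo)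
          (rest-fits (topWeight (lowers (map proj₂ P))) k τ μ δ _ (length (labels (lowers (lowers (map proj₂ P))))) (length (drop μ rest)) (labels-below (lowers (map proj₂ P))) hi
            (subst (λ n → (k + τ) * suc δ + length (labels (lowers (map proj₂ P))) ≤ τ * n)
              (trans (cong length (sym (take++drop≡id μ rest))) (trans (length-++ (take μ rest)) (cong (_+ length (drop μ rest)) len′))) more)))
      where
      len′ : length (take μ rest) ≡ μ
      len′ = trans (length-take μ rest) (m≤n⇒m⊓n≡m (*-cancelˡ-≤ τ {{>-nonZero 1≤τ}} (block-fits (topWeight (lowers (map proj₂ P))) k τ μ δ _ (length (labels (lowers (lowers (map proj₂ P))))) (length rest)
          (labels-below (lowers (map proj₂ P))) hi more)))

-- Oriented trees as forests

lookup-injective : ∀ {l : List A} → Unique l → ∀ {i j} → lookup l i ≡ lookup l j → i ≡ j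
lookup-injective (x∉ ∷ u) {Fin.zero} {Fin.zero} eq = refl
lookup-injective (x∉ ∷ u) {Fin.zero} {Fin.suc j} eq = contradiction eq (All.lookup x∉ (∈-lookup j))
lookup-injective (x∉ ∷ u) {Fin.suc i} {Fin.zero} eq = contradiction (sym eq) (All.lookup x∉ (∈-lookup i))
lookup-injective (x∉ ∷ u) {Fin.suc i} {Fin.suc j} eq = cong Fin.suc (lookup-injective u eq)

data Path {A : Set} (R : A → A → Set) : A → A → List A → Set where
  here : ∀ {a} → Path R a a (a ∷ [])
  step : ∀ {a b c l} → R a b → Path R b c l → Path R a c (a ∷ l)

module _ {A : Set} {R : A → A → Set} where

  path-++ : ∀ {a b c d l l′} → Path R a b l → R b c → Path R c d l′ → Path R a d (l ++ l′)
  path-++ here r p = step r p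
  path-++ (step s q) r p = step s (path-++ q r p)

  path-reverse : (∀ {x y} → R x y → R y x) → ∀ {a b l} → Path R a b l → Path R b a (reverse l)
  path-reverse symR here = here
  path-reverse symR (step {a} {l = l} r p) = subst (Path R _ _) (sym (unfold-reverse a l)) (snoc (path-reverse symR p) (symR r))
    where
    snoc : ∀ {x y z l} → Path R x y l → R y z → Path R x z (l ∷ʳ z)
    snoc p r = path-++ p r here

  path-head : ∀ {a b x l} → Path R a b (x ∷ l) → x ≡ a
  path-head here = refl
  path-head (step _ _) = refl

  path-last : ∀ {a b x} l → Path R a b (x ∷ l) → lookup (x ∷ l) (fromℕ (length l)) ≡ b
  path-last [] here = refl
  path-last [] (step _ ())
  path-last (y ∷ l) (step r p) = path-last l p

  path-steps : ∀ {a b x} l → Path R a b (x ∷ l) → ∀ (i : Fin (length l)) → R (lookup (x ∷ l) (inject₁ i)) (lookup l i)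
  path-steps (y ∷ l) (step r p) Fin.zero with refl ← path-head p = r
  path-steps (y ∷ l) (step r p) (Fin.suc i) = path-steps l p i

module _ {m : ℕ} (E : Digraph m) (oriented : IsOriented E) (acyclic : ¬ HasCycle E) where

  adj : Fin m → Fin m → Set
  adj u v = Adj E u v ≡ true

  adj-sym : ∀ {u v} → adj u v → adj v u
  adj-sym {u} {v} h = trans (∨-comm (E v u) (E u v)) h

  edge⇒adj : ∀ {u v} → E u v ≡ true → adj u v
  edge⇒adj {u} {v} e rewrite e = refl

  no-closed-path : ∀ {x y l} → Path adj x y l → Unique l → 3 ≤ length l → adj y x → ⊥
  no-closed-path {l = []} p u ()
  no-closed-path {l = _ ∷ []} p u (s≤s ())
  no-closed-path {l = _ ∷ _ ∷ []} p u (s≤s (s≤s ()))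
  no-closed-path {l = a ∷ b ∷ c ∷ l} p u _ back = acyclic (length l , lookup (a ∷ b ∷ c ∷ l)
    , lookup-injective u , path-steps (b ∷ c ∷ l) p
    , subst₂ adj (sym (path-last (b ∷ c ∷ l) p)) (sym (path-head p)) back)

  AttachedTo : Fin m → Forest (Fin m) → Set
  AttachedTo p f = ∀ {y} → y ∈ roots f → E p y ≡ true

  -- The path follows the parents. That it stays inside the tree is recorded so that two such paths
  -- on different sides of a tree edge can be joined to a simple path.
  climb : ∀ p f → DFS E f → AttachedTo p f → Unique (p ∷ verts f) → ∀ {x} → x ∈ p ∷ verts f →
    Σ (List (Fin m)) λ l → Path adj x p l × Unique l × (∀ {y} → y ∈ l → y ∈ p ∷ verts f)
  climb p f ok att un (here refl) = p ∷ [] , here , [] ∷ [] , λ { (here refl) → here refl }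
  climb p (node w fs gs) (node toRoots _ ok₁ ok₂) att (p∉ ∷ un) {x} (there x∈) with ∈-++⁻ (w ∷ verts fs) x∈
  ... | inj₁ x∈fs with l , path , unl , l⊆ ← climb w fs ok₁ toRoots (Unique-++ˡ (w ∷ verts fs) un) x∈fs =
    l ++ p ∷ [] , path-++ path (adj-sym (edge⇒adj (att (here refl)))) here
    , Uniqueₚ.++⁺ unl ([] ∷ []) (λ { (y∈ , here refl) → All.lookup p∉ (∈-++⁺ˡ (l⊆ y∈)) refl })
    , λ y∈ → [ there ∘ ∈-++⁺ˡ ∘ l⊆ , (λ { (here refl) → here refl }) ]′ (∈-++⁻ l y∈)
  ... | inj₂ x∈gs with l , path , unl , l⊆ ← climb p gs ok₂ (att ∘ there)
                         (All.tabulate (λ y∈ → All.lookup p∉ (∈-++⁺ʳ (w ∷ verts fs) y∈)) ∷ Unique-++ʳ (w ∷ verts fs) un) (there x∈gs) =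
    l , path , unl , λ y∈ → lift (l⊆ y∈)
    where
    lift : ∀ {y} → y ∈ p ∷ verts gs → y ∈ p ∷ w ∷ verts fs ++ verts gs
    lift (here refl) = here refl
    lift (there y∈) = there (∈-++⁺ʳ (w ∷ verts fs) y∈)

  path-long : ∀ {R : Fin m → Fin m → Set} {a b l} → Path R a b l → a ≢ b → 2 ≤ length l
  path-long here a≢b = contradiction refl a≢b
  path-long (step r here) a≢b = s≤s (s≤s z≤n)
  path-long (step r (step _ _)) a≢b = s≤s (s≤s z≤n)

  path-nonempty : ∀ {R : Fin m → Fin m → Set} {a b l} → Path R a b l → 1 ≤ length l
  path-nonempty here = s≤s z≤n
  path-nonempty (step _ _) = s≤s z≤n

  -- A second edge between the two sides of a tree edge would close a cycle.
  edges-in-forest : ∀ p f → DFS E f → AttachedTo p f → Unique (p ∷ verts f) →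
    ∀ {x y} → x ∈ p ∷ verts f → y ∈ p ∷ verts f → E x y ≡ true → Edge (node p f ∅) x y
  edges-in-forest p ∅ ok att un (here refl) (here refl) e = contradiction (trans (sym e) (proj₁ oriented p)) true≢false
  edges-in-forest p (node w fs gs) (node toRoots _ ok₁ ok₂) att (p∉ ∷ un) {x} {y} x∈ y∈ e = go (side x∈) (side y∈)
    where
    unW = Unique-++ˡ (w ∷ verts fs) un
    unQ : Unique (p ∷ verts gs)
    unQ = All.tabulate (λ y∈ → All.lookup p∉ (∈-++⁺ʳ (w ∷ verts fs) y∈)) ∷ Unique-++ʳ (w ∷ verts fs) un
    side : ∀ {z} → z ∈ p ∷ w ∷ verts fs ++ verts gs → z ∈ w ∷ verts fs ⊎ z ∈ p ∷ verts gs
    side (here refl) = inj₂ (here refl)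
    side (there z∈) with ∈-++⁻ (w ∷ verts fs) z∈
    ... | inj₁ z∈W = inj₁ z∈W
    ... | inj₂ z∈gs = inj₂ (there z∈gs)
    apart : ∀ {z} → z ∈ w ∷ verts fs → z ∈ p ∷ verts gs → ⊥
    apart z∈ (here refl) = All.lookup p∉ (∈-++⁺ˡ z∈) refl
    apart z∈ (there z∈gs) = Unique-++-disjoint (w ∷ verts fs) un z∈ z∈gs
    pw : E p w ≡ true
    pw = att (here refl)
    -- From `a` up to `w`, over the edge to `p`, down to `b`, and back to `a`; two climbs with three
    -- vertices in total make this a genuine cycle.
    cycle : ∀ {a b l₁ l₂} → Path adj a w l₁ → Path adj b p l₂ → Unique l₁ → Unique l₂ →
      (∀ {z} → z ∈ l₁ → z ∈ w ∷ verts fs) → (∀ {z} → z ∈ l₂ → z ∈ p ∷ verts gs) → adj b a → 3 ≤ length l₁ + length l₂ → ⊥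
    cycle {l₁ = l₁} {l₂} p₁ p₂ u₁ u₂ ⊆₁ ⊆₂ ba long =
      no-closed-path (path-++ p₁ (adj-sym (edge⇒adj pw)) (path-reverse adj-sym p₂))
        (Uniqueₚ.++⁺ u₁ (Unique-↭ (↭-sym (↭.↭-reverse l₂)) u₂)
          λ (z∈₁ , z∈₂) → apart (⊆₁ z∈₁) (⊆₂ (∈-resp-↭ (↭.↭-reverse l₂) z∈₂)))
        (≤-trans long (≤-reflexive (sym (trans (length-++ l₁) (cong (length l₁ +_) (length-reverse l₂)))))) ba
    cross : ∀ {a b} → a ∈ w ∷ verts fs → b ∈ p ∷ verts gs → adj b a → a ≡ w × b ≡ p
    cross {a} {b} a∈ b∈ ba with climb w fs ok₁ toRoots unW a∈ | climb p gs ok₂ (att ∘ there) unQ b∈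
    ... | l₁ , p₁ , u₁ , ⊆₁ | l₂ , p₂ , u₂ , ⊆₂ with a Fin.≟ w | b Fin.≟ p
    ...   | yes a≡w | yes b≡p = a≡w , b≡p
    ...   | yes _ | no b≢p = ⊥-elim (close (+-mono-≤ (path-nonempty p₁) (path-long p₂ b≢p)))
      where
      close = cycle p₁ p₂ u₁ u₂ ⊆₁ ⊆₂ ba
    ...   | no a≢w | _ = ⊥-elim (close (+-mono-≤ (path-long p₁ a≢w) (path-nonempty p₂)))
      where
      close = cycle p₁ p₂ u₁ u₂ ⊆₁ ⊆₂ ba
    go : x ∈ w ∷ verts fs ⊎ x ∈ p ∷ verts gs → y ∈ w ∷ verts fs ⊎ y ∈ p ∷ verts gs → Edge (node p (node w fs gs) ∅) x y
    go (inj₁ x∈W) (inj₁ y∈W) = child (lift (edges-in-forest w fs ok₁ toRoots unW x∈W y∈W e))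
      where
      lift : ∀ {a b} → Edge (node w fs ∅) a b → Edge (node w fs gs) a b
      lift (root b∈) = root b∈
      lift (child e) = child e
    go (inj₂ x∈Q) (inj₂ y∈Q) = lift (edges-in-forest p gs ok₂ (att ∘ there) unQ x∈Q y∈Q e)
      where
      lift : ∀ {a b} → Edge (node p gs ∅) a b → Edge (node p (node w fs gs) ∅) a b
      lift (root b∈) = root (there b∈)
      lift (child e) = child (sibling e)
    go (inj₂ x∈Q) (inj₁ y∈W) with refl , refl ← cross y∈W x∈Q (edge⇒adj e) = root (here refl)
    go (inj₁ x∈W) (inj₂ y∈Q) with refl , refl ← cross x∈W y∈Q (adj-sym (edge⇒adj e)) =
      contradiction (trans (sym e) (proj₂ oriented p w pw)) true≢false

  -- Reachability from `r` is stated through closed sets of vertices, to be applied to the explored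
  -- set: no edge leaves it when the search stops.
  tree⇒forest : ∀ r → (∀ {S} → r ∈ S → (∀ {u v} → u ∈ S → E u v ≡ true → v ∈ S) → ∀ v → v ∈ S) →
    Σ (Forest (Fin m)) λ f → r ∷ verts f ↭ allFin m ×
    (∀ {x y} → E x y ≡ true → Edge (node r f ∅) x y)
  tree⇒forest r reach with a , b , eq ← ∈-∃++ (∈-allFin r) with dfs E (length (a ++ b)) (E r) (a ++ b) ≤-refl
  ... | f , U′ , p , ok , toRoots , none , noEdges = f , perm , λ {x} {y} → edges-in-forest r f ok toRoots unF (all∈ x) (all∈ y)
    where
    whole : r ∷ verts f ++ U′ ↭ allFin m
    whole = ↭-trans (prep r p) (↭-trans (↭-sym (shift r a b)) (↭-reflexive (sym eq)))
    unAll : Unique (r ∷ verts f ++ U′)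
    unAll = Unique-↭ (↭-sym whole) (Uniqueₚ.allFin⁺ m)
    unF : Unique (r ∷ verts f)
    unF = Unique-++ˡ (r ∷ verts f) unAll
    closed : ∀ {u v} → u ∈ r ∷ verts f → E u v ≡ true → v ∈ r ∷ verts f
    closed {u} {v} u∈ e with ∈-++⁻ (r ∷ verts f) (∈-resp-↭ (↭-sym whole) (∈-allFin v))
    ... | inj₁ v∈ = v∈
    closed (here refl) e | inj₂ v∈U = contradiction (trans (sym e) (none v∈U)) true≢false
    closed (there u∈) e | inj₂ v∈U = contradiction (trans (sym e) (noEdges u∈ v∈U)) true≢false
    all∈ : ∀ v → v ∈ r ∷ verts f
    all∈ = reach (here refl) closed
    empty : ∀ U → (∀ {v} → v ∈ U → ⊥) → U ≡ []
    empty [] h = refl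
    empty (x ∷ U) h with () ← h (here refl)
    perm : r ∷ verts f ↭ allFin m
    perm = subst (_↭ allFin m) (trans (cong ((r ∷ verts f) ++_) (empty U′ λ v∈ → Unique-++-disjoint (r ∷ verts f) unAll (all∈ _) v∈))
                                      (++-identityʳ (r ∷ verts f))) whole

-- Choice of the parameters

length-take-drop : ∀ μ (l : List A) → μ ≤ length l → length (take μ l) ≡ μ × length l ≡ μ + length (drop μ l)
length-take-drop μ l μ≤ = len , trans (cong length (sym (take++drop≡id μ l))) (trans (length-++ (take μ l)) (cong (_+ length (drop μ l)) len))
  where
  len = trans (length-take μ l) (m≤n⇒m⊓n≡m μ≤)

first-fits : ∀ k τ D l μ M → τ * μ ≤ suc k + τ → (k + τ) * (2 + D) + suc l ≤ τ * M → τ * μ ≤ τ * M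
first-fits k τ D l μ M hi room = ≤-trans hi (≤-trans (m≤m+n _ (k + k * D + τ + τ * D + l)) (≤-trans (≤-reflexive (eq k τ D l)) room))
  where
  eq : ∀ k t D l → suc k + t + (k + k * D + t + t * D + l) ≡ (k + t) * (2 + D) + suc l
  eq = solve-∀

after-first : ∀ k τ D l μ M → τ * μ ≤ suc k + τ → (k + τ) * (2 + D) + suc l ≤ τ * (μ + M) → (k + τ) * suc D + l ≤ τ * M
after-first k τ D l μ M hi room = linear 0 (+-mono-≤ hi room) (eq k τ D l μ M)
  where
  eq : ∀ k t D l μ M → (k + t) * suc D + l + (suc k + t + t * (μ + M)) + 0 ≡ t * M + (t * μ + ((k + t) * (2 + D) + suc l))
  eq = solve-∀

-- Rounding `N / d` down loses at most a factor 2, as the quotient is at least 1.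
floor : ∀ d N → 1 ≤ d → d ≤ N → Σ ℕ λ τ → 1 ≤ τ × d * τ ≤ N × N ≤ 2 * (d * τ)
floor d@(suc _) N _ d≤N = N / d , m≥n⇒m/n>0 d≤N , ≤-trans (≤-reflexive (*-comm d (N / d))) (m/n*n≤m N d)
  , linear 0 (+-mono-≤ (+-mono-≤ (≤-reflexive (m≡m%n+[m/n]*n N d)) (<⇒≤ (m%n<n N d))) (*-monoʳ-≤ d (m≥n⇒m/n>0 d≤N)))
      (eq N (N % d) (N / d) d)
  where
  eq : ∀ N r t d → N + (r + t * d + d + d * t) + 0 ≡ 2 * (d * t) + (N + r + d * 1)
  eq = solve-∀

-- From `3 * τ + 1 ≤ 4 * τ` the incomplete cells of the `n` levels waste at most `4 * e * n * τ`
-- vertices, which is at most half of all. The other half fills the `M` cells.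
many-cells : ∀ e n τ M N → 1 ≤ τ → 8 * e * n * τ ≤ N → N ≤ e * (3 * τ + 1) * M + n * (e * (3 * τ + 1)) → N ≤ 8 * e * (τ * M)
many-cells e n τ M N 1≤τ small cover = linear 0
  (+-mono-≤ (+-mono-≤ (+-mono-≤ small (*-monoʳ-≤ 2 cover)) (*-monoʳ-≤ (2 * e * M) 1≤τ)) (*-monoʳ-≤ (2 * e * n) 1≤τ)) (eq e n τ M N)
  where
  eq : ∀ e n t M N → N + (N + 2 * (e * (3 * t + 1) * M + n * (e * (3 * t + 1))) + 2 * e * M * t + 2 * e * n * t) + 0
                   ≡ 8 * e * (t * M) + (8 * e * n * t + 2 * N + 2 * e * M * 1 + 2 * e * n * 1)
  eq = solve-∀

-- Since `τ ≤ m`, `deep` yields `τ * (2 + D) ≤ 3 * m`. After doubling, the terms with `k` may use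
-- one `N`: this needs `48 * e * m * k ≤ N * τ`, which follows from `N ≤ 16 * e * n * τ` and
-- `768 = 16 * 48`. The other terms add up to `80 * e * m`, of which 48 stem from the rounding and
-- 32 from `suc m`.
levels-fit : ∀ e n m k τ M N D t → 1 ≤ e → 1 ≤ n → 1 ≤ τ → τ ≤ m → N ≤ 8 * e * (τ * M) → N ≤ 2 * (8 * e * n * τ) →
  768 * e * e * (n * m * k) ≤ N * N → 80 * e * m ≤ N → τ * D + t ≤ m → (k + τ) * (2 + D) + suc m ≤ τ * M
levels-fit e n m k τ M N D t 1≤e 1≤n 1≤τ τ≤m many N≤ nmk m-small deep =
  *-cancelˡ-≤ (8 * e) {{>-nonZero (*-mono-≤ {1} {8} (s≤s z≤n) 1≤e)}} (≤-trans whole many)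
  where
  mk : 48 * e * m * k ≤ N * τ
  mk = *-cancelˡ-≤ (16 * e * n) {{>-nonZero (*-mono-≤ (*-mono-≤ {1} {16} (s≤s z≤n) 1≤e) 1≤n)}}
    (≤-trans (≤-reflexive (eq₁ e n m k)) (≤-trans nmk (≤-trans (*-monoʳ-≤ N N≤) (≤-reflexive (eq₂ e n τ N)))))
    where
    eq₁ : ∀ e n m k → 16 * e * n * (48 * e * m * k) ≡ 768 * e * e * (n * m * k)
    eq₁ = solve-∀
    eq₂ : ∀ e n t N → N * (2 * (8 * e * n * t)) ≡ 16 * e * n * (N * t)
    eq₂ = solve-∀
  blocks : 16 * e * (k * (2 + D)) ≤ N
  blocks = *-cancelˡ-≤ τ {{>-nonZero 1≤τ}} (linear (16 * e * k * t)
    (+-mono-≤ (+-mono-≤ mk (*-monoʳ-≤ (16 * e * k) deep)) (*-monoʳ-≤ (32 * e * k) τ≤m)) (eq e m k τ N D t))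
    where
    eq : ∀ e m k τ N D t → τ * (16 * e * (k * (2 + D))) + (N * τ + 16 * e * k * m + 32 * e * k * m) + 16 * e * k * t
                         ≡ τ * N + (48 * e * m * k + 16 * e * k * (τ * D + t) + 32 * e * k * τ)
    eq = solve-∀
  whole : 8 * e * ((k + τ) * (2 + D) + suc m) ≤ N
  whole = *-cancelˡ-≤ 2 (linear (16 * e * t)
    (+-mono-≤ (+-mono-≤ (+-mono-≤ (+-mono-≤ blocks m-small) (*-monoʳ-≤ (16 * e) deep)) (*-monoʳ-≤ (32 * e) τ≤m))
              (*-monoʳ-≤ (16 * e) (≤-trans 1≤τ τ≤m))) (eq e m k τ N D t))
    where
    eq : ∀ e m k τ N D t → 2 * (8 * e * ((k + τ) * (2 + D) + suc m)) + (N + N + 16 * e * m + 32 * e * m + 16 * e * m) + 16 * e * t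
         ≡ 2 * N + (16 * e * (k * (2 + D)) + 80 * e * m + 16 * e * (τ * D + t) + 32 * e * τ + 16 * e * 1)
    eq = solve-∀

-- Blue path or red tree

Copy : ∀ {V L : Set} → (V → V → Bool) → L → Forest L → Set
Copy {V} {L} R r fs = Σ (List (L × V)) λ asg → map proj₁ asg ↭ r ∷ verts fs × Unique (map proj₂ asg) ×
  (∀ {x y} → Edge (node r fs ∅) x y → Joined R asg (x , y))

module _ {V L : Set} (_≟_ : DecidableEquality V) (Rd Bl : V → V → Bool)
         (complete : ∀ {x y} → x ≢ y → (Rd x y ≡ true ⊎ Rd y x ≡ true) ⊎ (Bl x y ≡ true ⊎ Bl y x ≡ true))
         (e τ k : ℕ) (1≤e : 1 ≤ e) (1≤τ : 1 ≤ τ)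
         (pseudorandom : ∀ X Y → Unique (X ++ Y) → k ≤ length X → k ≤ length Y →
            length X * length Y ≤ e * sum (map (λ x → count (λ y → Rd x y ∨ Bl x y) Y) X)) where

  module Q = Embedding {V} {L} _≟_ Rd Bl complete e τ k 1≤e 1≤τ pseudorandom

  -- One cell is a red tournament with more than `3 * τ` vertices and holds a tree on at most `τ` of
  -- them. This case stands apart because `levels-fit` assumes `τ ≤ m`.
  embed-small : ∀ cs → Cells Bl (e * (3 * τ + 1)) cs → 1 ≤ length cs → ∀ (r : L) fs → size fs < τ → Copy Rd r fs
  embed-small (c ∷ cs) cl _ r fs small =
    let asg , labs , un , _ , joined = tree-in-tournament _≟_ Rd c r fs (Unique-++ˡ c (Cells.unique cl))
          (Q.clique (All.head (Cells.inside cl)))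
          (≤-trans (≤-trans (n≤1+n _) (≤-trans (≤-reflexive (sym (*-suc 2 (length (verts fs)))))
             (*-monoʳ-≤ 2 (subst (_< τ) (sym (length-verts fs)) small))))
           (≤-trans (≤-trans (*-monoˡ-≤ τ {2} {3} (s≤s (s≤s z≤n))) (m≤m+n (3 * τ) 1))
             (≤-trans (m≤n*m (3 * τ + 1) e {{>-nonZero 1≤e}}) (≤-reflexive (sym (All.head (Cells.size cl)))))))
    in asg , labs , un , joined

  -- The cells cs₀ only serve to provide a vertex u with many red neighbours in the block of the root.
  embed-large : ∀ cs → Cells Bl (e * (3 * τ + 1)) cs → ∀ r fs c → forget c ≡ node r fs ∅ → Light τ c →
    (k + τ) * (2 + depth c) + suc (size (forget c)) ≤ τ * length cs → Copy Rd r fs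
  embed-large cs cl r fs c eq light room
    -- At most `k` vertices of the first block are poor, so `suc k` guarantees one that is not.
    with μ₀ , lo₀ , hi₀ ← ceiling τ (suc k) 1≤τ
    with len₀ , split₀ ← length-take-drop μ₀ cs (*-cancelˡ-≤ τ {{>-nonZero 1≤τ}} (first-fits k τ (depth c) (size (forget c)) μ₀ (length cs) hi₀ room))
    with room₁ ← after-first k τ (depth c) (size (forget c)) μ₀ (length (drop μ₀ cs)) hi₀ (subst (λ n → _ ≤ τ * n) split₀ room)
    with μ₁ , lo₁ , hi₁ ← ceiling τ (Q.topWeight (c ∷ []) + k) 1≤τ =
    start (take μ₀ cs) (take μ₁ (drop μ₀ cs)) (drop μ₁ (drop μ₀ cs))
      (subst (Cells Bl Q.q) (trans (sym (take++drop≡id μ₀ cs)) (cong (take μ₀ cs ++_) (sym (take++drop≡id μ₁ (drop μ₀ cs))))) cl)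
      (≤-trans lo₀ (≤-reflexive (cong (τ *_) (sym len₀))))
      (≤-trans lo₁ (≤-reflexive (cong (τ *_) (sym len₁))))
      (rest-fits (Q.topWeight (c ∷ [])) k τ μ₁ (depth c) (size (forget c)) _ (length (drop μ₁ (drop μ₀ cs))) below-root hi₁
        (subst (λ n → (k + τ) * suc (depth c) + size (forget c) ≤ τ * n) split₁ room₁))
    where
    below-root : size (forget c) ≡ Q.topWeight (c ∷ []) + length (labels (Q.lowers (c ∷ [])))
    below-root = trans (sym (trans (cong length (++-identityʳ (verts (forget c)))) (length-verts (forget c)))) (Q.labels-below (c ∷ []))
    lens = length-take-drop μ₁ (drop μ₀ cs) (*-cancelˡ-≤ τ {{>-nonZero 1≤τ}}
      (block-fits (Q.topWeight (c ∷ [])) k τ μ₁ (depth c) (size (forget c)) _ (length (drop μ₀ cs)) below-root hi₁ room₁))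
    len₁ = proj₁ lens
    split₁ = proj₂ lens
    start : ∀ cs₀ cs₁ rest → Cells Bl Q.q (cs₀ ++ (cs₁ ++ rest)) → k < τ * length cs₀ → Q.topWeight (c ∷ []) + k ≤ τ * length cs₁ →
      (k + τ) * depth c + length (labels (Q.lowers (c ∷ []))) ≤ τ * length rest → Copy Rd r fs
    start cs₀ cs₁ rest cl′ large₀ large₁ room′ = convert (Q.embed-levels (depth c) ((proj₁ hub , c) ∷ []) cs₁ rest
        (proj₁ (proj₂ (cells-++⁻ cs₀ cl′))) (λ { (here refl) → Q.rich cs₁ (proj₁ hub) (proj₂ (proj₂ (proj₂ hub))) , light , ≤-refl }) large₁ room′)
      where
      cl₀₁ = proj₁ (cells-++⁻ (cs₀ ++ cs₁) (subst (Cells Bl Q.q) (sym (++-assoc cs₀ cs₁ rest)) cl′))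
      hub : Σ V λ u → u ∈ concat cs₀ × true ≡ true × Q.poor cs₁ u ≡ false
      hub = count-witness (Q.poor cs₁) (λ _ → true) (concat cs₀) (≤-<-trans
        (Q.few-poor cs₀ cs₁ cl₀₁ (≤-trans (m≤n+m k _) (≤-trans large₁ (*-monoˡ-≤ (length cs₁) Q.τ≤q))))
        (<-≤-trans large₀ (≤-trans (*-monoˡ-≤ (length cs₀) Q.τ≤q) (≤-reflexive (sym (trans (count-all (λ _ → true) (concat cs₀) (λ _ → refl))
          (length-concat Q.q cs₀ (Cells.size (proj₁ (cells-++⁻ cs₀ cl₀₁))))))))))
      convert : Outcome Rd ((proj₁ hub , c) ∷ []) (concat cs₁ ++ concat rest) → Copy Rd r fs
      convert (asg , labs , un , _ , em) = asg
        , ↭-trans labs (↭-reflexive (trans (++-identityʳ _) (trans (cong verts eq) (cong (r ∷_) (++-identityʳ (verts fs))))))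
        , un , λ {x} {y} ed → proj₂ (em (here refl)) (subst (λ f → Edge f x y) (sym eq) ed)

unique-map : ∀ {B : Set} (f : A → B) {l} → Unique (map f l) → ∀ {x y} → x ∈ l → y ∈ l → f x ≡ f y → x ≡ y
unique-map f (_ ∷ u) (here refl) (here refl) eq = refl
unique-map f (x∉ ∷ u) (here refl) (there y∈) eq = contradiction eq (All.lookup x∉ (∈-map⁺ f y∈))
unique-map f (x∉ ∷ u) (there x∈) (here refl) eq = contradiction (sym eq) (All.lookup x∉ (∈-map⁺ f x∈))
unique-map f (_ ∷ u) (there x∈) (there y∈) eq = unique-map f u x∈ y∈ eq

-- Stated for two abstract relations, so that it applies both to the colouring and to its reversal.
path-or-tree : ∀ {N m} (Rd Bl : Fin N → Fin N → Bool) →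
  (∀ {x y} → x ≢ y → (Rd x y ≡ true ⊎ Rd y x ≡ true) ⊎ (Bl x y ≡ true ⊎ Bl y x ≡ true)) → (∀ v → Bl v v ≡ false) →
  ∀ e k → 1 ≤ e →
  (∀ X Y → Unique (X ++ Y) → k ≤ length X → k ≤ length Y →
     length X * length Y ≤ e * sum (map (λ x → count (λ y → Rd x y ∨ Bl x y) Y) X)) →
  ∀ n (T : Digraph m) → IsOriented T → ¬ HasCycle T → ∀ r →
  (∀ {S} → r ∈ S → (∀ {u v} → u ∈ S → T u v ≡ true → v ∈ S) → ∀ v → v ∈ S) →
  80 * e * m ≤ N → 8 * e * suc n ≤ N → 768 * e * e * (suc n * m * k) ≤ N * N →
  (Σ (List (Fin N)) λ p → length p ≡ suc n × IsPath Bl p) ⊎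
  (Σ (Fin m → Fin N) λ φ → Injective _≡_ _≡_ φ × (∀ {x y} → T x y ≡ true → Rd (φ x) (φ y) ≡ true))
path-or-tree {N} {m} Rd Bl complete irr e k 1≤e pr n T oriented acyclic r reach m-small n-small nmk-small
  with levelling Fin._≟_ Bl irr n (allFin N) (Uniqueₚ.allFin⁺ N) | floor (8 * e * suc n) N (*-mono-≤ (*-mono-≤ {1} {8} (s≤s z≤n) 1≤e) (s≤s z≤n)) n-small
... | inj₁ path | _ = inj₁ path
... | inj₂ lev | τ , 1≤τ , lo , hi = inj₂ (φ , φ-injective , φ-edge)
  where
  q′ = e * (3 * τ + 1)
  instance
    q≢0 : NonZero q′
    q≢0 = >-nonZero (*-mono-≤ 1≤e (m≤n+m 1 (3 * τ)))
  forest = tree⇒forest T oriented acyclic r reach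
  f = proj₁ forest
  f↭ = proj₁ (proj₂ forest)
  m≡ : suc (size f) ≡ m
  m≡ = trans (cong suc (sym (length-verts f))) (trans (↭-length f↭) (length-tabulate id))
  cellsΣ = levelling⇒cells Bl (suc n) (pred q′) (allFin N) (Uniqueₚ.allFin⁺ N) ∈-allFin lev
  cs = proj₁ cellsΣ
  cl : Cells Bl q′ cs
  cl = subst (λ q → Cells Bl q cs) (suc-pred q′) (proj₁ (proj₂ cellsΣ))
  cover : N ≤ 8 * e * (τ * length cs)
  cover = many-cells e (suc n) τ (length cs) N 1≤τ lo (≤-trans (≤-reflexive (sym (length-tabulate id))) (≤-trans (proj₂ (proj₂ cellsΣ))
    (+-mono-≤ (≤-reflexive (cong (_* length cs) (suc-pred q′))) (*-monoʳ-≤ (suc n) (pred[n]≤n {q′})))))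
  copy : Copy Rd r f
  copy with m ≤? τ
  ... | yes m≤τ = embed-small Fin._≟_ Rd Bl complete e τ k 1≤e 1≤τ pr cs cl (nonempty cs cover) r f (subst (_≤ τ) (sym m≡) m≤τ)
    where
    nonempty : ∀ cs → N ≤ 8 * e * (τ * length cs) → 1 ≤ length cs
    nonempty [] cov = contradiction (≤-trans (*-mono-≤ (*-mono-≤ {1} {8} (s≤s z≤n) 1≤e) (s≤s z≤n)) (≤-trans n-small
      (≤-trans cov (≤-reflexive (trans (cong (8 * e *_) (*-zeroʳ τ)) (*-zeroʳ (8 * e))))))) λ ()
    nonempty (_ ∷ _) _ = s≤s z≤n
  ... | no m≰τ with c , eq , light , deep ← cutting τ (node r f ∅) =
    embed-large Fin._≟_ Rd Bl complete e τ k 1≤e 1≤τ pr cs cl r f c eq light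
      (subst (λ s → (k + τ) * (2 + depth c) + suc s ≤ τ * length cs) (sym (trans (cong size eq) m≡′))
        (levels-fit e (suc n) m k τ (length cs) N (depth c) (size (top c)) 1≤e (s≤s z≤n) 1≤τ (<⇒≤ (≰⇒> m≰τ)) cover hi nmk-small m-small
          (≤-trans deep (≤-reflexive m≡′))))
    where
    m≡′ : size (node r f ∅) ≡ m
    m≡′ = trans (cong suc (+-identityʳ (size f))) m≡
  asg = proj₁ copy
  labs : map proj₁ asg ↭ allFin m
  labs = ↭-trans (proj₁ (proj₂ copy)) f↭
  image : ∀ a → ∃ λ z → z ∈ asg × a ≡ proj₁ z
  image a = ∈-map⁻ proj₁ (∈-resp-↭ (↭-sym labs) (∈-allFin a))
  φ : Fin m → Fin N
  φ a = proj₂ (proj₁ (image a))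
  φ-injective : Injective _≡_ _≡_ φ
  φ-injective {a} {b} eq = trans (proj₂ (proj₂ (image a))) (trans
    (cong proj₁ (unique-map proj₂ (proj₁ (proj₂ (proj₂ copy))) (proj₁ (proj₂ (image a))) (proj₁ (proj₂ (image b))) eq))
    (sym (proj₂ (proj₂ (image b)))))
  φ-unique : ∀ {a x} → (a , x) ∈ asg → φ a ≡ x
  φ-unique {a} ax∈ = cong proj₂ (unique-map proj₁ (Unique-↭ (↭-sym labs) (Uniqueₚ.allFin⁺ m)) (proj₁ (proj₂ (image a))) ax∈
    (sym (proj₂ (proj₂ (image a)))))
  φ-edge : ∀ {x y} → T x y ≡ true → Rd (φ x) (φ y) ≡ true
  φ-edge t with u , v , u∈ , v∈ , uv ← proj₂ (proj₂ (proj₂ copy)) (proj₂ (proj₂ forest) t) =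
    subst₂ (λ a b → Rd a b ≡ true) (sym (φ-unique u∈)) (sym (φ-unique v∈)) uv

-- Transfer to subsets and colourings

sum-swap : ∀ {B : Set} (g : A → B → ℕ) xs ys →
  sum (map (λ x → sum (map (g x) ys)) xs) ≡ sum (map (λ y → sum (map (λ x → g x y) xs)) ys)
sum-swap g [] ys = sym (trans (sum-map-const 0 ys) refl)
sum-swap g (x ∷ xs) ys = trans (cong (sum (map (g x) ys) +_) (sum-swap g xs ys)) (sym (sum-map-+ (g x) _ ys))

sum-map-cong : ∀ (f g : A → ℕ) xs → (∀ x → f x ≡ g x) → sum (map f xs) ≡ sum (map g xs)
sum-map-cong f g xs h = cong sum (map-cong h xs)

module _ {N : ℕ} where

  open import Data.List.Membership.DecPropositional (Fin._≟_ {N}) using (_∈?_)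

  sum-single : ∀ (f : Fin N → ℕ) x U → Unique U → x ∈ U → sum (map (λ u → bit (does (u Fin.≟ x)) * f u) U) ≡ f x
  sum-single f x (u ∷ U) (u∉ ∷ un) x∈ with u Fin.≟ x | x∈
  ... | yes refl | _ = trans (cong₂ _+_ (+-identityʳ (f x)) (rest U u∉)) (+-identityʳ (f x))
    where
    rest : ∀ U → All (x ≢_) U → sum (map (λ u → bit (does (u Fin.≟ x)) * f u) U) ≡ 0
    rest [] _ = refl
    rest (y ∷ U) (x≢y ∷ u∉) rewrite dec-false (y Fin.≟ x) (x≢y ∘ sym) = rest U u∉
  ... | no u≢x | here refl = contradiction refl u≢x
  ... | no _ | there x∈U = sum-single f x U un x∈U

  -- Bridge from the sums over all vertices in `eCount` to sums over duplicate-free lists.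
  sum-members : ∀ (f : Fin N → ℕ) X → Unique X → sum (map (λ u → bit (does (u ∈? X)) * f u) (allFin N)) ≡ sum (map f X)
  sum-members f [] un = trans (sum-map-const 0 (allFin N)) refl
  sum-members f (x ∷ X) (x∉ ∷ un) = trans (sum-map-cong _ _ (allFin N) split)
    (trans (sum-map-+ (λ u → bit (does (u Fin.≟ x)) * f u) (λ u → bit (does (u ∈? X)) * f u) (allFin N))
      (cong₂ _+_ (sum-single f x (allFin N) (Uniqueₚ.allFin⁺ N) (∈-allFin x)) (sum-members f X un)))
    where
    split : ∀ u → bit (does (u ∈? (x ∷ X))) * f u ≡ bit (does (u Fin.≟ x)) * f u + bit (does (u ∈? X)) * f u
    split u with u Fin.≟ x | u ∈? X
    ... | yes refl | yes u∈X = contradiction refl (All.lookup x∉ u∈X)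
    ... | yes _ | no _ = sym (+-identityʳ _)
    ... | no _ | yes _ = refl
    ... | no _ | no _ = refl

  subset : List (Fin N) → Subset N
  subset X = Vec.tabulate λ v → does (v ∈? X)

  lookup-subset : ∀ X v → Vec.lookup (subset X) v ≡ does (v ∈? X)
  lookup-subset X v = lookup∘tabulate (λ v → does (v ∈? X)) v

  ∣tabulate∣ : ∀ {n} (p : Fin n → Bool) → ∣ Vec.tabulate p ∣ ≡ sum (tabulate (bit ∘ p))
  ∣tabulate∣ {zero} p = refl
  ∣tabulate∣ {suc n} p with p Fin.zero
  ... | true = cong suc (∣tabulate∣ (p ∘ Fin.suc))
  ... | false = ∣tabulate∣ (p ∘ Fin.suc)

  ∣subset∣ : ∀ X → Unique X → ∣ subset X ∣ ≡ length X
  ∣subset∣ X un = trans (∣tabulate∣ (λ v → does (v ∈? X))) (trans (cong sum (sym (map-tabulate id (λ v → bit (does (v ∈? X))))))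
    (trans (sum-map-cong _ _ (allFin N) (λ v → sym (*-identityʳ (bit (does (v ∈? X))))))
      (trans (sum-members (λ _ → 1) X un) (trans (sum-map-const 1 X) (*-identityˡ _)))))

  eCount-subset : ∀ (E : Digraph N) X Y → Unique X → Unique Y →
    eCount E (subset X) (subset Y) ≡ sum (map (λ x → count (E x) Y) X)
  eCount-subset E X Y unX unY = trans (sum-map-cong _ _ (allFin N) row) (sum-members (λ x → count (E x) Y) X unX)
    where
    bit-∧ : ∀ a b → bit (a ∧ b) ≡ bit a * bit b
    bit-∧ true b = sym (+-identityʳ (bit b))
    bit-∧ false b = refl
    row : ∀ u → count (λ v → Vec.lookup (subset X) u ∧ Vec.lookup (subset Y) v ∧ E u v) (allFin N)
              ≡ bit (does (u ∈? X)) * count (E u) Y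
    row u = trans (sum-map-cong _ _ (allFin N) λ v → trans (bit-∧ (Vec.lookup (subset X) u) (Vec.lookup (subset Y) v ∧ E u v))
                (cong₂ (λ a b → bit a * b) (lookup-subset X u)
                  (trans (bit-∧ (Vec.lookup (subset Y) v) (E u v)) (cong (λ b → bit b * bit (E u v)) (lookup-subset Y v)))))
      (trans (sum-map-* (bit (does (u ∈? X))) _ (allFin N)) (cong (bit (does (u ∈? X)) *_) (sum-members (λ v → bit (E u v)) Y unY)))

log₂ : ∀ N → 1 ≤ N → Σ ℕ λ L → 2 ^ L ≤ N × N < 2 ^ suc L
log₂ (suc zero) _ = 0 , ≤-refl , ≤-refl
log₂ (suc (suc N)) _ with L , lo , hi ← log₂ (suc N) (s≤s z≤n) with suc (suc N) <? 2 ^ suc L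
... | yes hi′ = L , m≤n⇒m≤1+n lo , hi′
... | no ¬hi′ = suc L , ≮⇒≥ ¬hi′ , ≤-<-trans hi (subst (2 ^ suc L <_) (cong (2 ^ suc L +_) (sym (+-identityʳ (2 ^ suc L))))
                  (m<m+n (2 ^ suc L) (m^n>0 2 (suc L))))

^-cancelʳ-≤ : ∀ m n → 2 ^ m ≤ 2 ^ n → m ≤ n
^-cancelʳ-≤ m n h = ≮⇒≥ λ n<m → <⇒≱ (^-monoʳ-< 2 (s≤s (s≤s z≤n)) n<m) h

-- Comparing exponents in `2 ^ L ≤ N` and the hypothesis bounds `L * (c * c * n * m)` by `N * N`.
-- One of the two factors `c` absorbs all constants, including the 2 from `suc L ≤ L + L`; the other
-- is only bounded below by 1.
log-bound : ∀ e σ n m N L → 1 ≤ e → 1 ≤ σ → 1 ≤ L → 2 ^ L ≤ N →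
  N ^ (1536 * e * e * σ * (1536 * e * e * σ) * n * m) ≤ 2 ^ (N * N) → 768 * e * e * (n * m * (σ * suc L)) ≤ N * N
log-bound e σ n m N L 1≤e 1≤σ 1≤L lo h = begin
  768 * e * e * (n * m * (σ * suc L))       ≤⟨ *-monoʳ-≤ (768 * e * e) (*-monoʳ-≤ (n * m) (*-monoʳ-≤ σ (+-monoˡ-≤ L 1≤L))) ⟩
  768 * e * e * (n * m * (σ * (L + L)))     ≡⟨ eq₁ e σ n m L ⟩
  1 * (L * (c * n * m))                     ≤⟨ *-monoˡ-≤ (L * (c * n * m)) (*-mono-≤ (*-mono-≤ (*-mono-≤ {1} {1536} (s≤s z≤n) 1≤e) 1≤e) 1≤σ) ⟩
  c * (L * (c * n * m))                     ≡⟨ eq₂ c L n m ⟩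
  L * (c * c * n * m)                       ≤⟨ ^-cancelʳ-≤ _ _ power ⟩
  N * N                                     ∎
  where
  open ≤-Reasoning
  c = 1536 * e * e * σ
  eq₁ : ∀ e σ n m L → 768 * e * e * (n * m * (σ * (L + L))) ≡ 1 * (L * (1536 * e * e * σ * n * m))
  eq₁ = solve-∀
  eq₂ : ∀ c L n m → c * (L * (c * n * m)) ≡ L * (c * c * n * m)
  eq₂ = solve-∀
  power : 2 ^ (L * (c * c * n * m)) ≤ 2 ^ (N * N)
  power = ≤-trans (≤-reflexive (sym (^-*-assoc 2 L (c * c * n * m)))) (≤-trans (^-monoˡ-≤ (c * c * n * m) lo) h)

linked-lookup : ∀ {R : A → A → Set} {p} → Linked R p → ∀ i j → suc (toℕ i) ≡ toℕ j → R (lookup p i) (lookup p j)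
linked-lookup (r ∷ l) Fin.zero (Fin.suc Fin.zero) eq = r
linked-lookup (r ∷ l) (Fin.suc i) (Fin.suc j) eq = linked-lookup l i j (suc-injective eq)
linked-lookup [-] Fin.zero (Fin.suc ()) eq

isRed isBlue : Colour → Bool
isRed red = true
isRed blue = false
isBlue red = false
isBlue blue = true

module _ {N : ℕ} (G : Digraph N) (col : Fin N → Fin N → Colour) where

  Red Blue : Fin N → Fin N → Bool
  Red u v = G u v ∧ isRed (col u v)
  Blue u v = G u v ∧ isBlue (col u v)

  red⁻ : ∀ {u v} → Red u v ≡ true → G u v ≡ true × col u v ≡ red
  red⁻ {u} {v} h with G u v | col u v
  ... | true | red = refl , refl

  blue⁻ : ∀ {u v} → Blue u v ≡ true → G u v ≡ true × col u v ≡ blue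
  blue⁻ {u} {v} h with G u v | col u v
  ... | true | blue = refl , refl

  coloured : ∀ u v → Red u v ∨ Blue u v ≡ G u v
  coloured u v with G u v | col u v
  ... | true | red = refl
  ... | true | blue = refl
  ... | false | _ = refl

  red-or-blue : ∀ {u v} → G u v ≡ true → Red u v ≡ true ⊎ Blue u v ≡ true
  red-or-blue {u} {v} g with G u v | col u v
  red-or-blue refl | true | red = inj₁ refl
  red-or-blue refl | true | blue = inj₂ refl

  edge-either-way : IsTournament G → ∀ {x y} → x ≢ y → G x y ≡ true ⊎ G y x ≡ true
  edge-either-way (_ , tour) {x} {y} x≢y with G x y | tour x y x≢y
  ... | true | _ = inj₁ refl
  ... | false | eq with G y x
  ...   | true = inj₂ refl
  ...   | false = contradiction (sym eq) true≢false

  complete : IsTournament G → ∀ {x y} → x ≢ y → (Red x y ≡ true ⊎ Red y x ≡ true) ⊎ (Blue x y ≡ true ⊎ Blue y x ≡ true)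
  complete tour x≢y with edge-either-way tour x≢y
  ... | inj₁ g = Sum.map inj₁ inj₁ (red-or-blue g)
  ... | inj₂ g = Sum.map inj₂ inj₂ (red-or-blue g)

  blue-irreflexive : IsTournament G → ∀ v → Blue v v ≡ false
  blue-irreflexive (irr , _) v rewrite irr v = refl

  -- As `εp` and `σq` are at least 1, the density is at least `1 / εq` and the threshold `σ log N`
  -- is at most `σp * suc L`, by `N < 2 ^ suc L`.
  list-pseudorandom : ∀ εp εq σp σq L → 1 ≤ εp → 1 ≤ σq → N < 2 ^ suc L → PseudorandomLog G εp εq σp σq →
    ∀ X Y → Unique (X ++ Y) → σp * suc L ≤ length X → σp * suc L ≤ length Y →
    length X * length Y ≤ εq * sum (map (λ x → count (λ y → Red x y ∨ Blue x y) Y) X)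
  list-pseudorandom εp εq σp σq L 1≤εp 1≤σq hi pr X Y un largeX largeY = begin
    length X * length Y                      ≤⟨ m≤n*m _ εp {{>-nonZero 1≤εp}} ⟩
    εp * (length X * length Y)               ≡⟨ *-assoc εp (length X) (length Y) ⟨
    εp * length X * length Y                 ≡⟨ cong₂ (λ a b → εp * a * b) (∣subset∣ X unX) (∣subset∣ Y unY) ⟨
    εp * ∣ subset X ∣ * ∣ subset Y ∣          ≤⟨ pr (subset X) (subset Y) disjoint (large X unX largeX) (large Y unY largeY) ⟩
    εq * eCount G (subset X) (subset Y)      ≡⟨ cong (εq *_) (trans (eCount-subset G X Y unX unY) (sum-map-cong _ _ X λ x →
                                                  sum-map-cong _ _ Y λ y → cong bit (sym (coloured x y)))) ⟩
    εq * sum (map (λ x → count (λ y → Red x y ∨ Blue x y) Y) X) ∎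
    where
    open ≤-Reasoning
    open import Data.List.Membership.DecPropositional (Fin._≟_ {N}) using (_∈?_)
    unX = Unique-++ˡ X un
    unY = Unique-++ʳ X un
    disjoint : Disjoint (subset X) (subset Y)
    disjoint u (u∈X , u∈Y) = Unique-++-disjoint X un (does-true (u ∈? X) (trans (sym (lookup-subset X u)) u∈X))
                                                     (does-true (u ∈? Y) (trans (sym (lookup-subset Y u)) u∈Y))
    large : ∀ Z → Unique Z → σp * suc L ≤ length Z → N ^ σp ≤ 2 ^ (σq * ∣ subset Z ∣)
    large Z unZ big = begin
      N ^ σp                   ≤⟨ ^-monoˡ-≤ σp (<⇒≤ hi) ⟩
      (2 ^ suc L) ^ σp         ≡⟨ ^-*-assoc 2 (suc L) σp ⟩
      2 ^ (suc L * σp)         ≤⟨ ^-monoʳ-≤ 2 (≤-trans (≤-reflexive (*-comm (suc L) σp)) (≤-trans big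
                                   (≤-trans (m≤n*m _ σq {{>-nonZero 1≤σq}}) (≤-reflexive (cong (σq *_) (sym (∣subset∣ Z unZ))))))) ⟩
      2 ^ (σq * ∣ subset Z ∣)  ∎

-- Reachability along walks and the two orientations of the tree

walk-closed : ∀ {m} {R : Fin m → Fin m → Bool} {S : List (Fin m)} → (∀ {u v} → u ∈ S → R u v ≡ true → v ∈ S) →
  ∀ k (w : Fin (suc k) → Fin m) → w Fin.zero ∈ S → (∀ (i : Fin k) → R (w (inject₁ i)) (w (Fin.suc i)) ≡ true) → w (fromℕ k) ∈ S
walk-closed cl zero w w∈ st = w∈
walk-closed cl (suc k) w w∈ st = walk-closed cl k (w ∘ Fin.suc) (cl w∈ (st Fin.zero)) (st ∘ Fin.suc)

walk-closed′ : ∀ {m} {R : Fin m → Fin m → Bool} {S : List (Fin m)} → (∀ {u v} → v ∈ S → R u v ≡ true → u ∈ S) →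
  ∀ k (w : Fin (suc k) → Fin m) → w (fromℕ k) ∈ S → (∀ (i : Fin k) → R (w (inject₁ i)) (w (Fin.suc i)) ≡ true) → w Fin.zero ∈ S
walk-closed′ cl zero w w∈ st = w∈
walk-closed′ cl (suc k) w w∈ st = cl (walk-closed′ cl k (w ∘ Fin.suc) w∈ (st ∘ Fin.suc)) (st Fin.zero)

≡ᵇ-true : ∀ {a b} → (a ≡ᵇ b) ≡ true → a ≡ b
≡ᵇ-true {a} {b} h = ≡ᵇ⇒≡ a b (subst T (sym h) tt)

theorem4p1 : ∀ (εp εq σp σq : ℕ) → 0 < εp → 2 * εp < εq → 0 < σp → 0 < σq →
    Σ ℕ λ c → 0 < c ×
    (∀ (N : ℕ) (G : Digraph N) → IsTournament G → PseudorandomLog G εp εq σp σq →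
    ∀ (n m : ℕ) → c * n ≤ N → c * m ≤ N → N ^ (c * c * n * m) ≤ 2 ^ (N * N) →
    ∀ (T : Digraph m) → IsDirectedTree T → Arrows G (DirPath n) T)
theorem4p1 εp εq σp σq 0<εp 2εp<εq 0<σp 0<σq = c , 1≤c , go
  where
  -- Twice the `768 * εq * εq` of `levels-fit`, because `k = σp * suc L` is compared with `L`; this
  -- also exceeds the constants 80 and 8 of the two linear conditions.
  c = 1536 * εq * εq * σp
  1≤εq : 1 ≤ εq
  1≤εq = ≤-trans (s≤s z≤n) 2εp<εq
  1≤c : 1 ≤ c
  1≤c = *-mono-≤ (*-mono-≤ (*-mono-≤ {1} {1536} (s≤s z≤n) 1≤εq) 1≤εq) 0<σp
  c≥ : ∀ d → d ≤ 1536 → d * εq ≤ c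
  c≥ d d≤ = ≤-trans (*-monoˡ-≤ εq d≤) (≤-trans (m≤m*n (1536 * εq) εq {{>-nonZero 1≤εq}}) (m≤m*n (1536 * εq * εq) σp {{>-nonZero 0<σp}}))
  go : ∀ (N : ℕ) (G : Digraph N) → IsTournament G → PseudorandomLog G εp εq σp σq →
    ∀ (n m : ℕ) → c * n ≤ N → c * m ≤ N → N ^ (c * c * n * m) ≤ 2 ^ (N * N) →
    ∀ (T : Digraph m) → IsDirectedTree T → Arrows G (DirPath n) T
  go N G tour pr zero m cn cm h T tree col = inj₁ ((λ ()) , (λ {x} → ⊥-elim (Fin.¬Fin0 x)) , λ ())
  go N G tour pr (suc n) m cn cm h T ((oriented , _ , acyclic) , direction) col = solve direction
    where
    1≤N : 1 ≤ N
    1≤N = ≤-trans (*-mono-≤ 1≤c (s≤s {0} {n} z≤n)) cn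
    logN = log₂ N 1≤N
    L = proj₁ logN
    -- `N` is at least `c`, which is at least 2.
    1≤L : 1 ≤ L
    1≤L with L | proj₂ (proj₂ logN)
    ... | suc _ | _ = s≤s z≤n
    ... | zero | N<2 = contradiction N<2 (≤⇒≯ (≤-trans (*-mono-≤ (≤-trans (*-monoʳ-≤ 2 1≤εq) (c≥ 2 (m≤m+n 2 1534))) (s≤s {0} {n} z≤n)) cn))
    k = σp * suc L
    pseudorandom = list-pseudorandom G col εp εq σp σq L 0<εp 0<σq (proj₂ (proj₂ logN)) pr
    m-small : 80 * εq * m ≤ N
    m-small = ≤-trans (*-monoˡ-≤ m (c≥ 80 (m≤m+n 80 1456))) cm
    n-small : 8 * εq * suc n ≤ N
    n-small = ≤-trans (*-monoˡ-≤ (suc n) (c≥ 8 (m≤m+n 8 1528))) cn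
    nmk-small : 768 * εq * εq * (suc n * m * k) ≤ N * N
    nmk-small = log-bound εq σp (suc n) m N L 1≤εq 0<σp 1≤L (proj₁ (proj₂ logN)) h
    -- Reversed edges from `X` to `Y` are edges from `Y` to `X`, so the roles of the two sets and
    -- the order of summation are exchanged.
    pseudorandomᵒᵖ : ∀ X Y → Unique (X ++ Y) → k ≤ length X → k ≤ length Y →
      length X * length Y ≤ εq * sum (map (λ x → count (λ y → Red G col y x ∨ Blue G col y x) Y) X)
    pseudorandomᵒᵖ X Y un largeX largeY = subst₂ _≤_ (*-comm (length Y) (length X))
      (cong (εq *_) (sum-swap (λ y x → bit (Red G col y x ∨ Blue G col y x)) Y X))
      (pseudorandom Y X (Unique-↭ (↭.++-comm X Y) un) largeY largeX)
    acyclicᵒᵖ : ¬ HasCycle (λ x y → T y x)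
    acyclicᵒᵖ (l , w , inj , st , close) = acyclic (l , w , inj , (λ i → trans (∨-comm (T (w (inject₁ i)) (w (Fin.suc i))) _) (st i))
      , trans (∨-comm (T (w (fromℕ (suc (suc l)))) (w Fin.zero)) _) close)
    path-copy : ∀ p → IsPath (Blue G col) p → ColouredCopy G col blue (DirPath (length p))
    path-copy p (un , linked) = lookup p , lookup-injective un , λ i j e → blue⁻ G col (linked-lookup linked i j (≡ᵇ-true e))
    reversed-path-copy : ∀ p → IsPath (λ x y → Blue G col y x) p → ColouredCopy G col blue (DirPath (length p))
    reversed-path-copy p (un , linked) = (λ i → lookup p (Fin.opposite i))
      , (λ eq → opposite-injective (lookup-injective un eq))
      , λ i j e → blue⁻ G col (linked-lookup linked (Fin.opposite j) (Fin.opposite i) (opposite-suc i j (≡ᵇ-true e)))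
      where
      opposite-injective : ∀ {i j : Fin (length p)} → Fin.opposite i ≡ Fin.opposite j → i ≡ j
      opposite-injective {i} {j} eq = trans (sym (Fin.opposite-involutive i)) (trans (cong Fin.opposite eq) (Fin.opposite-involutive j))
      opposite-suc : ∀ (i j : Fin (length p)) → suc (toℕ i) ≡ toℕ j → suc (toℕ (Fin.opposite j)) ≡ toℕ (Fin.opposite i)
      opposite-suc i j eq = trans (cong suc (trans (Fin.opposite-prop j) (cong (λ t → length p ∸ suc t) (sym eq))))
        (trans (sym (+-∸-assoc 1 (subst (_< length p) (sym eq) (Fin.toℕ<n j)))) (sym (Fin.opposite-prop i)))
    solve : IsOutDirected T ⊎ IsInDirected T → ColouredCopy G col blue (DirPath (suc n)) ⊎ ColouredCopy G col red T
    solve (inj₁ (r , walks)) = Sum.map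
      (λ (p , len , path) → subst (λ n → ColouredCopy G col blue (DirPath n)) len (path-copy p path))
      (λ (φ , inj , edges) → φ , inj , λ x y t → red⁻ G col (edges t))
      (path-or-tree (Red G col) (Blue G col) (complete G col tour) (blue-irreflexive G col tour) εq k 1≤εq pseudorandom
        n T oriented acyclic r reach m-small n-small nmk-small)
      where
      reach : ∀ {S} → r ∈ S → (∀ {u v} → u ∈ S → T u v ≡ true → v ∈ S) → ∀ v → v ∈ S
      reach r∈ cl v with l , w , refl , refl , st ← walks v = walk-closed {R = T} cl l w r∈ st
    solve (inj₂ (r , walks)) = Sum.map
      (λ (p , len , path) → subst (λ n → ColouredCopy G col blue (DirPath n)) len (reversed-path-copy p path))
      (λ (φ , inj , edges) → φ , inj , λ x y t → red⁻ G col (edges t))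
      (path-or-tree (λ x y → Red G col y x) (λ x y → Blue G col y x) (Sum.map Sum.swap Sum.swap ∘ complete G col tour)
        (blue-irreflexive G col tour) εq k 1≤εq pseudorandomᵒᵖ n (λ x y → T y x)
        (proj₁ oriented , λ u v → proj₂ oriented v u) acyclicᵒᵖ r reach m-small n-small nmk-small)
      where
      reach : ∀ {S} → r ∈ S → (∀ {u v} → u ∈ S → T v u ≡ true → v ∈ S) → ∀ v → v ∈ S
      reach r∈ cl v with l , w , refl , refl , st ← walks v = walk-closed′ {R = T} cl l w r∈ st
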